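{- Let $g:\{\pm1\}^{m_1}\times\{\pm1\}^{m_2}\to\{\pm1\}$ be a gadget with $\hat g(S,T)=0$ whenever $S=\emptyset$ or $T=\emptyset$. Then for all $k,d,n$, $$L_{1,k}(g,d,m_1,m_2,n)\le\Bigl(\sum_{S,T}|\hat g(S,T)|\Bigr)^{k}L_{1,k}(\mathrm{XOR},d,1,1,n)\le 2^{(m_1+m_2)k/2}L_{1,k}(\mathrm{XOR},d,1,1,n).$$
   Context: $\hat g(S,T)=\mathbb{E}[g(\mathbf{x},\mathbf{y})\prod_{j\in S}\mathbf{x}_j\prod_{j\in T}\mathbf{y}_j]$ for uniform $\mathbf{x}\in\{\pm1\}^{m_1},\mathbf{y}\in\{\pm1\}^{m_2}$, and the sum is over all $S\subseteq[m_1],T\subseteq[m_2]$. For a randomized two-party protocol $\mathcal{C}:(\{\pm1\}^{m_1})^n\times(\{\pm1\}^{m_2})^n\to[-1,1]$ (value = expected output over internal randomness; inputs are $n$ blocks $x_i\in\{\pm1\}^{m_1}$, $y_i\in\{\pm1\}^{m_2}$), its $g$-fiber is $\mathcal{C}_{\downarrow g}(z)=\mathbb{E}[\mathcal{C}(\mathbf{x},\mathbf{y})\mid g(\mathbf{x}_i,\mathbf{y}_i)=z_i\ \forall i]$ for uniform $\mathbf{x},\mathbf{y}$. For $f:\{\pm1\}^n\to\mathbb{R}$, $L_{1,k}(f)=\sum_{|I|=k}|\hat f(I)|$. $L_{1,k}(g,d,m_1,m_2,n)$ denotes the supremum of $L_{1,k}(\mathcal{C}_{\downarrow g})$ over all such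 randomized protocols with at most $d$ bits of communication. $\mathrm{XOR}:\{\pm1\}\times\{\pm1\}\to\{\pm1\}$ is the gadget $\mathrm{XOR}(a,b)=ab$ (so $m_1=m_2=1$). -}

module Defs where

open import Algebra.Bundles using (CommutativeRing; Semiring)
import Algebra.Construct.NaturalChoice.Max as Max
import Algebra.Definitions.RawSemiring as RawSemiringDefs
import Algebra.Properties.Ring as RingProps
open import Data.Bool using (Bool)
open import Data.Empty using (⊥-elim)
open import Data.Fin using (Fin)
open import Data.Fin.Subset using (Subset; inside; outside)
import Data.Fin.Subset as Subset
open import Data.List using (List; []; _∷_; length; filter; cartesianProduct; cartesianProductWith; allFin)
open import Data.Nat using (ℕ; zero; suc)
import Data.Nat as ℕ
open import Data.Product using (Σ; _×_; _,_; proj₁; proj₂; ∃; uncurry)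
open import Data.Sign using (Sign)
import Data.Sign as Sign
import Data.Sign.Properties as Sign
open import Data.Sum using (inj₁; inj₂)
open import Data.Vec using (Vec; []; _∷_; zipWith)
open import Data.Vec.Properties using (≡-dec)
open import Level using (Level) renaming (suc to lsuc)
open import Relation.Binary using (Rel; IsDecTotalOrder; DecTotalOrder)
open import Relation.Nullary using (¬_)

-- Axioms for the real numbers.  Up to isomorphism ℝ is the only (classical)
-- model, so results are stated for an arbitrary model.  Equality is a setoid
-- equality; Set ℓ-indexed families stand for sets of reals in `complete`.

record CompleteOrderedField (ℓ : Level) : Set (lsuc ℓ) where
  field
    commutativeRing : CommutativeRing ℓ ℓ

  open CommutativeRing commutativeRing public

  infix 4 _≤_
  field
    _≤_             : Rel Carrier ℓ
    isDecTotalOrder : IsDecTotalOrder _≈_ _≤_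
    1≉0             : ¬ (1# ≈ 0#)
    inverse         : ∀ x → ¬ (x ≈ 0#) → ∃ λ y → x * y ≈ 1#
    +-monoʳ-≤       : ∀ x {y z} → y ≤ z → x + y ≤ x + z
    *-nonNeg        : ∀ {x y} → 0# ≤ x → 0# ≤ y → 0# ≤ x * y

  IsSupremum : {I : Set ℓ} → (I → Carrier) → Carrier → Set ℓ
  IsSupremum f s = (∀ i → f i ≤ s) × (∀ b → (∀ i → f i ≤ b) → s ≤ b)

  field
    complete : {I : Set ℓ} (f : I → Carrier) → I →
               (∃ λ b → ∀ i → f i ≤ b) → ∃ (IsSupremum f)

  ⨆ : {I : Set ℓ} (f : I → Carrier) → I → (∃ λ b → ∀ i → f i ≤ b) → Carrier
  ⨆ f i bound = proj₁ (complete f i bound)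

  decTotalOrder : DecTotalOrder ℓ ℓ ℓ
  decTotalOrder = record { isDecTotalOrder = isDecTotalOrder }

Cube : ℕ → Set
Cube m = Vec Sign m

words : ∀ {A : Set} → List A → (n : ℕ) → List (Vec A n)
words as zero    = [] ∷ []
words as (suc n) = cartesianProductWith _∷_ as (words as n)

cube : ∀ m → List (Cube m)
cube = words (Sign.+ ∷ Sign.- ∷ [])

subsets : ∀ m → List (Subset m)
subsets = words (inside ∷ outside ∷ [])

χ : ∀ {m} → Subset m → Cube m → Sign
χ []            []      = Sign.+
χ (inside  ∷ S) (s ∷ x) = s Sign.* χ S x
χ (outside ∷ S) (s ∷ x) = χ S x

Gadget : ℕ → ℕ → Set
Gadget m₁ m₂ = Cube m₁ → Cube m₂ → Sign

XOR : Gadget 1 1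
XOR (a ∷ []) (b ∷ []) = a Sign.* b

Inputs : ℕ → ℕ → Set
Inputs m n = Vec (Cube m) n

inputs : ∀ m₁ m₂ n → List (Inputs m₁ n × Inputs m₂ n)
inputs m₁ m₂ n = cartesianProduct (words (cube m₁) n) (words (cube m₂) n)

preimage : ∀ {m₁ m₂ n} → Gadget m₁ m₂ → Cube n → List (Inputs m₁ n × Inputs m₂ n)
preimage {m₁} {m₂} {n} g z =
  filter (λ (x , y) → ≡-dec Sign._≟_ (zipWith g x y) z) (inputs m₁ m₂ n)

-- Deterministic protocol trees of depth at most d.  The transcript so far
-- determines who speaks next, and the full transcript determines the output.

data Protocol (X Y : Set) : ℕ → Set where
  output : ∀ {d} → Sign → Protocol X Y d
  alice  : ∀ {d} → (X → Bool) → (Bool → Protocol X Y d) → Protocol X Y (suc d)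
  bob    : ∀ {d} → (Y → Bool) → (Bool → Protocol X Y d) → Protocol X Y (suc d)

run : ∀ {X Y d} → Protocol X Y d → X → Y → Sign
run (output s)  x y = s
run (alice b P) x y = run (P (b x)) x y
run (bob b P)   x y = run (P (b y)) x y

module Analysis {ℓ} (ℝ : CompleteOrderedField ℓ) where
  open CompleteOrderedField ℝ public
  open RawSemiringDefs (Semiring.rawSemiring (CommutativeRing.semiring commutativeRing)) public
    using (_^_) renaming (_×_ to _·_)
  open IsDecTotalOrder isDecTotalOrder public
    using () renaming (total to ≤-total; antisym to ≤-antisym; trans to ≤-trans;
                       reflexive to ≤-reflexive; refl to ≤-refl)
  open Max (DecTotalOrder.totalOrder decTotalOrder) public
  private module R = RingProps (CommutativeRing.ring commutativeRing)

  ∣_∣ : Carrier → Carrier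
  ∣ x ∣ = x ⊔ (- x)

  2# : Carrier
  2# = 1# + 1#

  ⟦_⟧ : Sign → Carrier
  ⟦ Sign.+ ⟧ = 1#
  ⟦ Sign.- ⟧ = - 1#

  ≤-respˡ : ∀ {x y z} → x ≈ y → x ≤ z → y ≤ z
  ≤-respˡ e p = ≤-trans (≤-reflexive (sym e)) p

  ≤-respʳ : ∀ {x y z} → x ≈ y → z ≤ x → z ≤ y
  ≤-respʳ e p = ≤-trans p (≤-reflexive e)

  +-mono-≤ : ∀ {w x y z} → w ≤ x → y ≤ z → w + y ≤ x + z
  +-mono-≤ {w} {x} {y} {z} p q = ≤-trans (+-monoʳ-≤ w q)
    (≤-respˡ (+-comm z w) (≤-respʳ (+-comm z x) (+-monoʳ-≤ z p)))

  x≤y⇒0≤y-x : ∀ {x y} → x ≤ y → 0# ≤ y - x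
  x≤y⇒0≤y-x {x} {y} p =
    ≤-respˡ (-‿inverseˡ x) (≤-respʳ (+-comm (- x) y) (+-monoʳ-≤ (- x) p))

  0≤y-x⇒x≤y : ∀ {x y} → 0# ≤ y - x → x ≤ y
  0≤y-x⇒x≤y {x} {y} p = ≤-respˡ (+-identityʳ x) (≤-respʳ
    (trans (+-congˡ (+-comm y (- x))) (trans (sym (+-assoc x (- x) y))
      (trans (+-congʳ (-‿inverseʳ x)) (+-identityˡ y))))
    (+-monoʳ-≤ x p))

  x≤0⇒0≤-x : ∀ {x} → x ≤ 0# → 0# ≤ - x
  x≤0⇒0≤-x p = ≤-respʳ (+-identityˡ _) (x≤y⇒0≤y-x p)

  *-monoʳ-≤ : ∀ {w x y} → 0# ≤ w → x ≤ y → w * x ≤ w * y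
  *-monoʳ-≤ {w} {x} {y} 0≤w p = 0≤y-x⇒x≤y (≤-respʳ
    (trans (distribˡ w y (- x)) (+-congˡ (sym (R.-‿distribʳ-* w x))))
    (*-nonNeg 0≤w (x≤y⇒0≤y-x p)))

  0≤1 : 0# ≤ 1#
  0≤1 with ≤-total 0# 1#
  ... | inj₁ p = p
  ... | inj₂ p = ≤-respʳ
    (trans (R.-1*x≈-x (- 1#)) (R.-‿involutive 1#))
    (*-nonNeg (x≤0⇒0≤-x p) (x≤0⇒0≤-x p))

  0≤n·1 : ∀ n → 0# ≤ n · 1#
  0≤n·1 zero    = ≤-refl
  0≤n·1 (suc n) = ≤-respˡ (+-identityˡ 0#) (+-mono-≤ 0≤1 (0≤n·1 n))

  1≤1+n·1 : ∀ n → 1# ≤ suc n · 1#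
  1≤1+n·1 n = ≤-respˡ (+-identityʳ 1#) (+-monoʳ-≤ 1# (0≤n·1 n))

  1+n·1≉0 : ∀ n → ¬ (suc n · 1# ≈ 0#)
  1+n·1≉0 n e = 1≉0 (≤-antisym (≤-respʳ e (1≤1+n·1 n)) 0≤1)

  recip : ℕ → Carrier
  recip zero    = 0#
  recip (suc n) = proj₁ (inverse (suc n · 1#) (1+n·1≉0 n))

  recip-inverse : ∀ n → suc n · 1# * recip (suc n) ≈ 1#
  recip-inverse n = proj₂ (inverse (suc n · 1#) (1+n·1≉0 n))

  0≤recip : ∀ n → 0# ≤ recip n
  0≤recip zero = ≤-refl
  0≤recip (suc n) with ≤-total 0# (recip (suc n))
  ... | inj₁ p = p
  ... | inj₂ p = ⊥-elim (1≉0 (≤-antisym 1≤0 0≤1))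
    where
    1≤0 : 1# ≤ 0#
    1≤0 = ≤-respˡ (recip-inverse n) (≤-respʳ (zeroʳ _)
      (*-monoʳ-≤ (0≤n·1 (suc n)) p))

  recip*n≤1 : ∀ n → recip n * (n · 1#) ≤ 1#
  recip*n≤1 zero    = ≤-respˡ (sym (zeroˡ 0#)) 0≤1
  recip*n≤1 (suc n) = ≤-reflexive (trans (*-comm _ _) (recip-inverse n))

  ∣∣-cong : ∀ {x y} → x ≈ y → ∣ x ∣ ≈ ∣ y ∣
  ∣∣-cong e = ⊔-cong e (-‿cong e)

  ∣x+y∣≤ : ∀ x y → ∣ x + y ∣ ≤ ∣ x ∣ + ∣ y ∣
  ∣x+y∣≤ x y = ⊔-lub (+-mono-≤ (x≤x⊔y x (- x)) (x≤x⊔y y (- y)))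
    (≤-respˡ (R.-‿+-comm x y)
      (+-mono-≤ (x≤y⊔x x (- x)) (x≤y⊔x y (- y))))

  ∣w*x∣≤ : ∀ {w} x → 0# ≤ w → ∣ w * x ∣ ≤ w * ∣ x ∣
  ∣w*x∣≤ {w} x p = ⊔-lub (*-monoʳ-≤ p (x≤x⊔y x (- x)))
    (≤-respˡ (sym (R.-‿distribʳ-* w x)) (*-monoʳ-≤ p (x≤y⊔x x (- x))))

  ∣-x∣≤ : ∀ x → ∣ - x ∣ ≤ ∣ x ∣
  ∣-x∣≤ x = ⊔-lub (x≤y⊔x x (- x)) (≤-respˡ (sym (R.-‿involutive x)) (x≤x⊔y x (- x)))

  ∣0∣≤0 : ∣ 0# ∣ ≤ 0#
  ∣0∣≤0 = ⊔-lub ≤-refl (≤-reflexive R.-0#≈0#)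

  ∣1∣≤1 : ∣ 1# ∣ ≤ 1#
  ∣1∣≤1 = ⊔-lub ≤-refl (0≤y-x⇒x≤y (≤-respʳ (+-congˡ (sym (R.-‿involutive 1#)))
    (≤-respˡ (+-identityˡ 0#) (+-mono-≤ 0≤1 0≤1))))

  ∣sign∣≤1 : ∀ s → ∣ ⟦ s ⟧ ∣ ≤ 1#
  ∣sign∣≤1 Sign.+ = ∣1∣≤1
  ∣sign∣≤1 Sign.- = ≤-trans (∣-x∣≤ 1#) ∣1∣≤1

  ∣x*sign∣≤ : ∀ x s → ∣ x * ⟦ s ⟧ ∣ ≤ ∣ x ∣
  ∣x*sign∣≤ x Sign.+ = ≤-reflexive (∣∣-cong (*-identityʳ x))
  ∣x*sign∣≤ x Sign.- = ≤-respˡ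
    (∣∣-cong (trans (-‿cong (sym (*-identityʳ x))) (R.-‿distribʳ-* x 1#))) (∣-x∣≤ x)

  infixr 5 ∑ 𝔼

  ∑ : ∀ {A : Set} → List A → (A → Carrier) → Carrier
  ∑ []       f = 0#
  ∑ (a ∷ as) f = f a + ∑ as f

  syntax ∑ as (λ a → e) = ∑[ a ← as ] e

  -- Uniform average over a list; the empty average is 0, which
  -- matters only when conditioning on a null event.
  𝔼 : ∀ {A : Set} → List A → (A → Carrier) → Carrier
  𝔼 as f = recip (length as) * ∑ as f

  syntax 𝔼 as (λ a → e) = 𝔼[ a ← as ] e

  ∑-mono : ∀ {A : Set} (as : List A) {f g} → (∀ a → f a ≤ g a) → ∑ as f ≤ ∑ as g
  ∑-mono []       p = ≤-refl
  ∑-mono (a ∷ as) p = +-mono-≤ (p a) (∑-mono as p)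

  ∑-one : ∀ {A : Set} (as : List A) → (∑[ a ← as ] 1#) ≈ length as · 1#
  ∑-one []       = refl
  ∑-one (a ∷ as) = +-congˡ (∑-one as)

  ∣∑∣≤ : ∀ {A : Set} (as : List A) f → ∣ ∑ as f ∣ ≤ ∑[ a ← as ] ∣ f a ∣
  ∣∑∣≤ []       f = ∣0∣≤0
  ∣∑∣≤ (a ∷ as) f = ≤-trans (∣x+y∣≤ (f a) (∑ as f)) (+-monoʳ-≤ ∣ f a ∣ (∣∑∣≤ as f))

  ∣𝔼∣≤1 : ∀ {A : Set} (as : List A) {f} → (∀ a → ∣ f a ∣ ≤ 1#) → ∣ 𝔼 as f ∣ ≤ 1#
  ∣𝔼∣≤1 as {f} p = ≤-trans (∣w*x∣≤ (∑ as f) (0≤recip (length as)))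
    (≤-trans (*-monoʳ-≤ (0≤recip (length as))
      (≤-trans (∣∑∣≤ as f) (≤-respʳ (∑-one as) (∑-mono as p))))
      (recip*n≤1 (length as)))

  x²≤2⇒x≤2 : ∀ x → x * x ≤ 2# → x ≤ 2#
  x²≤2⇒x≤2 x p with ≤-total x 2#
  ... | inj₁ q = q
  ... | inj₂ q = ≤-trans (≤-respˡ (+-identityʳ x) (+-monoʳ-≤ x 0≤x))
                   (≤-trans (≤-respˡ (trans (distribˡ x 1# 1#)
                     (+-cong (*-identityʳ x) (*-identityʳ x))) (*-monoʳ-≤ 0≤x q)) p)
    where
    0≤2 : 0# ≤ 2#
    0≤2 = ≤-respˡ (+-identityˡ 0#) (+-mono-≤ 0≤1 0≤1)
    0≤x : 0# ≤ x
    0≤x = ≤-trans 0≤2 q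

  √2 : Carrier
  √2 = ⨆ {I = Σ Carrier λ x → x * x ≤ 2#} proj₁
         (0# , ≤-respˡ (sym (zeroˡ 0#)) (≤-respˡ (+-identityˡ 0#) (+-mono-≤ 0≤1 0≤1)))
         (2# , uncurry x²≤2⇒x≤2)

  fourier : ∀ {n} → (Cube n → Carrier) → Subset n → Carrier
  fourier {n} f I = 𝔼[ z ← cube n ] f z * ⟦ χ I z ⟧

  gadgetFourier : ∀ {m₁ m₂} → Gadget m₁ m₂ → Subset m₁ → Subset m₂ → Carrier
  gadgetFourier {m₁} {m₂} g S T =
    𝔼 (cartesianProduct (cube m₁) (cube m₂)) λ (x , y) → ⟦ g x y ⟧ * ⟦ χ S x ⟧ * ⟦ χ T y ⟧

  subsetsOfSize : ∀ n → ℕ → List (Subset n)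
  subsetsOfSize n k = filter (λ I → Subset.∣ I ∣ ℕ.≟ k) (subsets n)

  L₁ : ∀ {n} → ℕ → (Cube n → Carrier) → Carrier
  L₁ {n} k f = ∑[ I ← subsetsOfSize n k ] ∣ fourier f I ∣

  -- A finitely supported probability distribution on deterministic protocols.
  -- Since X and Y will be finite, there are finitely many deterministic
  -- protocols up to extensional equality, so finite support costs nothing;
  -- private coins and randomized outputs are included as they can be drawn in
  -- advance.
  record RandomizedProtocol (X Y : Set) (d : ℕ) : Set ℓ where
    field
      outcomes : ℕ
      weight   : Fin outcomes → Carrier
      nonNeg   : ∀ r → 0# ≤ weight r
      total    : (∑[ r ← allFin outcomes ] weight r) ≈ 1#
      protocol : Fin outcomes → Protocol X Y d

    value : X → Y → Carrier
    value x y = ∑[ r ← allFin outcomes ] weight r * ⟦ run (protocol r) x y ⟧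

  open RandomizedProtocol public using (value)

  -- Conditioning the uniform distribution on an event is averaging over the
  -- inputs in that event.
  fiber : ∀ {m₁ m₂ n d} (g : Gadget m₁ m₂) →
          RandomizedProtocol (Inputs m₁ n) (Inputs m₂ n) d → Cube n → Carrier
  fiber g C z = 𝔼[ xy ← preimage g z ] uncurry (value C) xy

  ∣value∣≤1 : ∀ {X Y d} (C : RandomizedProtocol X Y d) x y → ∣ value C x y ∣ ≤ 1#
  ∣value∣≤1 C x y = ≤-trans (∣∑∣≤ (allFin outcomes) _) (≤-respʳ total
    (∑-mono (allFin outcomes) λ r → ≤-trans (∣w*x∣≤ _ (nonNeg r))
      (≤-respʳ (*-identityʳ (weight r)) (*-monoʳ-≤ (nonNeg r) (∣sign∣≤1 (run (protocol r) x y))))))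
    where open RandomizedProtocol C hiding (value)

  ∣fiber∣≤1 : ∀ {m₁ m₂ n d} (g : Gadget m₁ m₂)
              (C : RandomizedProtocol (Inputs m₁ n) (Inputs m₂ n) d) z → ∣ fiber g C z ∣ ≤ 1#
  ∣fiber∣≤1 g C z = ∣𝔼∣≤1 (preimage g z) λ (x , y) → ∣value∣≤1 C x y

  L₁-bounded : ∀ {n} k (f : Cube n → Carrier) → (∀ z → ∣ f z ∣ ≤ 1#) →
               L₁ k f ≤ length (subsetsOfSize n k) · 1#
  L₁-bounded {n} k f p = ≤-respʳ (∑-one (subsetsOfSize n k))
    (∑-mono (subsetsOfSize n k) λ I →
      ∣𝔼∣≤1 (cube n) λ z → ≤-trans (∣x*sign∣≤ (f z) (χ I z)) (p z))

  constant : ∀ {X Y d} → RandomizedProtocol X Y d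
  constant = record
    { outcomes = 1
    ; weight   = λ _ → 1#
    ; nonNeg   = λ _ → 0≤1
    ; total    = +-identityʳ 1#
    ; protocol = λ _ → output Sign.+
    }

  L₁sup : ∀ {m₁ m₂} → Gadget m₁ m₂ → (k d n : ℕ) → Carrier
  L₁sup {m₁} {m₂} g k d n =
    ⨆ {I = RandomizedProtocol (Inputs m₁ n) (Inputs m₂ n) d}
      (λ C → L₁ k (fiber g C))
      constant
      (length (subsetsOfSize n k) · 1# , λ C → L₁-bounded k (fiber g C) (∣fiber∣≤1 g C))

{-# OPTIONS --safe #-}
-- Replacing x by the point obtained from a uniform u by multiplying one
-- coordinate in S ≠ ∅ by a sign a gives a uniform point with χ_S(x) = a χ_S(u).
-- Expanding g in characters, and choosing (S, T) in each block with probability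
-- κ ∣ĝ(S,T)∣, where κ = 1 / ∑ ∣ĝ∣, therefore writes κᵏ times a level-k
-- coefficient of the g-fiber of C as a signed average of the corresponding
-- coefficients of XOR-fibers of protocols that run C on transformed inputs.
-- The second inequality is Cauchy–Schwarz, by Parseval ∑ ĝ² = 1.

module Submission where

open import Defs
open import Algebra.Bundles using (CommutativeRing)
import Algebra.Properties.Ring as RingProperties
import Algebra.Properties.Semiring.Exp as Exp
import Algebra.Properties.Semiring.Mult as Mult
import Algebra.Solver.Ring.NaturalCoefficients.Default as Solver
import Data.Bool as Bool
open import Data.Empty using (⊥-elim)
open import Data.Fin.Subset using (Subset; ⊥; inside; outside)
import Data.Fin.Subset as Subset
open import Data.List using (List; []; _∷_; _++_; length; map; filter; cartesianProduct; cartesianProductWith; allFin)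
open import Data.List.Properties using (length-++; length-map)
open import Data.Nat using (ℕ; zero; suc)
import Data.Nat as ℕ
open import Data.Product using (Σ; _×_; _,_; proj₁; proj₂; uncurry)
open import Data.Sign using (Sign)
import Data.Sign as Sign
import Data.Sign.Properties as Sign
open import Data.Sum using (_⊎_; inj₁; inj₂)
open import Data.Vec using (Vec; []; _∷_; head; zipWith; replicate)
open import Data.Vec.Properties using (≡-dec)
open import Level using (Level) renaming (zero to lzero; suc to lsuc; _⊔_ to _⊔ˡ_)
import Relation.Binary.PropositionalEquality as ≡
open import Relation.Binary.PropositionalEquality using (_≡_; _≢_)
import Relation.Binary.Reasoning.Setoid as SetoidReasoning
open import Relation.Nullary using (¬_; yes; no)
open import Relation.Unary using (Pred; Decidable)

-- The obstacle is the sum of absolute values over all `I` of size k: the random choice of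
-- simulating protocol must not depend on `I`, or the separate bounds for the coefficients could not
-- be assembled into the level-k weight of a single XOR-fiber. Hence every block, inside `I` or not,
-- receives a random (S, T, u, v) from one fixed distribution, and `I` influences only the sign
-- attached to a choice. A block outside `I` must merely end up with uniform inputs; the factor κ is
-- paid only on blocks inside. The masks u and v are shared randomness. For a fixed choice each
-- player computes the new block from the own sign and own mask, so the simulator is C with
-- privately relabelled inputs and communicates no more than C. The vanishing hypothesis acts in two
-- places. At (∅, ∅) it makes g unbiased, so all events g(x_i, y_i) = z_i have the same probability
-- and a Fourier coefficient of the fiber becomes a plain correlation of C with a product of values
-- of g. At the other pairs with an empty side it removes the terms of the expansion in which there
-- is no coordinate to carry the player's sign.

module _ {ℓ : Level} (ℝ : CompleteOrderedField ℓ) where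
  open Analysis ℝ
  open SetoidReasoning setoid
  open RingProperties (CommutativeRing.ring commutativeRing)
    using (-‿distribˡ-*; -‿distribʳ-*; -‿involutive; -‿+-comm)
  open Exp semiring using (^-homo-*)
  open Mult semiring using (×1-homo-*)
  open Solver commutativeSemiring using (solve; _:=_; _:+_; _:*_; con)

  private variable
    A B D : Set
    m m₁ m₂ n d : ℕ

  -- Finite sums.

  ∑-cong : (as : List A) {f g : A → Carrier} → (∀ a → f a ≈ g a) → ∑ as f ≈ ∑ as g
  ∑-cong []       e = refl
  ∑-cong (a ∷ as) e = +-cong (e a) (∑-cong as e)

  ∑-zero : (as : List A) → (∑[ a ← as ] 0#) ≈ 0#
  ∑-zero []       = refl
  ∑-zero (a ∷ as) = trans (+-identityˡ _) (∑-zero as)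

  ∑-+ : (as : List A) (f g : A → Carrier) → (∑[ a ← as ] f a + g a) ≈ ∑ as f + ∑ as g
  ∑-+ []       f g = sym (+-identityˡ 0#)
  ∑-+ (a ∷ as) f g = trans (+-congˡ (∑-+ as f g))
    (solve 4 (λ p q r s → (p :+ q) :+ (r :+ s) := (p :+ r) :+ (q :+ s)) refl _ _ _ _)

  *-∑ : (as : List A) (c : Carrier) (f : A → Carrier) → c * ∑ as f ≈ (∑[ a ← as ] c * f a)
  *-∑ []       c f = zeroʳ c
  *-∑ (a ∷ as) c f = trans (distribˡ c _ _) (+-congˡ (*-∑ as c f))

  ∑-* : (as : List A) (c : Carrier) (f : A → Carrier) → ∑ as f * c ≈ (∑[ a ← as ] f a * c)
  ∑-* as c f = trans (*-comm _ c) (trans (*-∑ as c f) (∑-cong as λ a → *-comm c (f a)))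

  ∑-swap : (as : List A) (bs : List B) (f : A → B → Carrier) →
           (∑[ a ← as ] ∑[ b ← bs ] f a b) ≈ (∑[ b ← bs ] ∑[ a ← as ] f a b)
  ∑-swap []       bs f = sym (∑-zero bs)
  ∑-swap (a ∷ as) bs f = trans (+-congˡ (∑-swap as bs f)) (sym (∑-+ bs _ _))

  ∑-++ : (as bs : List A) (f : A → Carrier) → ∑ (as ++ bs) f ≈ ∑ as f + ∑ bs f
  ∑-++ []       bs f = sym (+-identityˡ _)
  ∑-++ (a ∷ as) bs f = trans (+-congˡ (∑-++ as bs f)) (sym (+-assoc _ _ _))

  ∑-map : (k : A → B) (as : List A) (f : B → Carrier) → ∑ (map k as) f ≈ (∑[ a ← as ] f (k a))
  ∑-map k []       f = refl
  ∑-map k (a ∷ as) f = +-congˡ (∑-map k as f)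

  ∑-productWith : (k : A → B → D) (as : List A) (bs : List B) (f : D → Carrier) →
                  ∑ (cartesianProductWith k as bs) f ≈ (∑[ a ← as ] ∑[ b ← bs ] f (k a b))
  ∑-productWith k []       bs f = refl
  ∑-productWith k (a ∷ as) bs f = trans (∑-++ (map (k a) bs) _ f)
    (+-cong (∑-map (k a) bs f) (∑-productWith k as bs f))

  length-productWith : (k : A → B → D) (as : List A) (bs : List B) →
                       length (cartesianProductWith k as bs) ≡ length as ℕ.* length bs
  length-productWith k []       bs = ≡.refl
  length-productWith k (a ∷ as) bs = ≡.trans (length-++ (map (k a) bs))
    (≡.cong₂ ℕ._+_ (length-map (k a) bs) (length-productWith k as bs))

  -- Reciprocals of natural numbers.

  nonzero·1 : ∀ p → p · 1# ≈ 0# → p ≡ 0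
  nonzero·1 zero    e = ≡.refl
  nonzero·1 (suc p) e = ⊥-elim (1+n·1≉0 p e)

  recip-unit : ∀ p → ¬ (p · 1# ≈ 0#) → p · 1# * recip p ≈ 1#
  recip-unit zero    p≉0 = ⊥-elim (p≉0 refl)
  recip-unit (suc p) p≉0 = recip-inverse p

  -- With the convention `recip 0` = `0#` this survives p = 0, because c = 0 then follows from the
  -- product equation. So a fiber can be renormalised before its preimage is known to be nonempty.
  recip-quotient : ∀ a p c → ¬ (a · 1# ≈ 0#) → a · 1# * p · 1# ≈ c · 1# → recip p ≈ a · 1# * recip c
  recip-quotient a zero c a≉0 e with nonzero·1 c (trans (sym e) (zeroʳ _))
  ... | ≡.refl = sym (zeroʳ _)
  recip-quotient a p@(suc p′) c a≉0 e = begin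
    recip p                               ≈⟨ *-identityʳ _ ⟨
    recip p * 1#                          ≈⟨ *-congˡ (recip-unit c c≉0) ⟨
    recip p * (c · 1# * recip c)          ≈⟨ *-congˡ (*-congʳ e) ⟨
    recip p * (a · 1# * p · 1# * recip c) ≈⟨ solve 4 (λ r a p s → r :* (a :* p :* s) := (p :* r) :* (a :* s)) refl _ _ _ _ ⟩
    p · 1# * recip p * (a · 1# * recip c) ≈⟨ *-congʳ (recip-inverse p′) ⟩
    1# * (a · 1# * recip c)               ≈⟨ *-identityˡ _ ⟩
    a · 1# * recip c                      ∎
    where
    c≉0 : ¬ (c · 1# ≈ 0#)
    c≉0 c≈0 = a≉0 (begin
      a · 1#                      ≈⟨ *-identityʳ _ ⟨
      a · 1# * 1#                 ≈⟨ *-congˡ (recip-inverse p′) ⟨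
      a · 1# * (p · 1# * recip p) ≈⟨ *-assoc _ _ _ ⟨
      a · 1# * p · 1# * recip p   ≈⟨ *-congʳ (trans e c≈0) ⟩
      0# * recip p                ≈⟨ zeroˡ _ ⟩
      0#                          ∎)

  recip-* : ∀ a b → recip (a ℕ.* b) ≈ recip a * recip b
  recip-* zero      b = sym (zeroˡ _)
  recip-* a@(suc a′) b = begin
    recip (a ℕ.* b)                       ≈⟨ *-identityˡ _ ⟨
    1# * recip (a ℕ.* b)                  ≈⟨ *-congʳ (trans (*-comm _ _) (recip-inverse a′)) ⟨
    recip a * a · 1# * recip (a ℕ.* b)    ≈⟨ *-assoc _ _ _ ⟩
    recip a * (a · 1# * recip (a ℕ.* b))  ≈⟨ *-congˡ (recip-quotient a b (a ℕ.* b) (1+n·1≉0 a′) (sym (×1-homo-* a b))) ⟨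
    recip a * recip b                     ∎

  -- Uniform averages over lists, signs and cubes.

  𝔼-cong : (as : List A) {f g : A → Carrier} → (∀ a → f a ≈ g a) → 𝔼 as f ≈ 𝔼 as g
  𝔼-cong as e = *-congˡ (∑-cong as e)

  𝔼-+ : (as : List A) (f g : A → Carrier) → (𝔼[ a ← as ] f a + g a) ≈ 𝔼 as f + 𝔼 as g
  𝔼-+ as f g = trans (*-congˡ (∑-+ as f g)) (distribˡ _ _ _)

  *-𝔼 : (as : List A) (c : Carrier) (f : A → Carrier) → c * 𝔼 as f ≈ (𝔼[ a ← as ] c * f a)
  *-𝔼 as c f = trans (solve 3 (λ c r s → c :* (r :* s) := r :* (c :* s)) refl _ _ _) (*-congˡ (*-∑ as c f))

  𝔼-* : (as : List A) (c : Carrier) (f : A → Carrier) → 𝔼 as f * c ≈ (𝔼[ a ← as ] f a * c)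
  𝔼-* as c f = trans (*-comm _ c) (trans (*-𝔼 as c f) (𝔼-cong as λ a → *-comm c (f a)))

  𝔼-∑ : (as : List A) (bs : List B) (f : A → B → Carrier) →
        (𝔼[ a ← as ] ∑[ b ← bs ] f a b) ≈ (∑[ b ← bs ] 𝔼[ a ← as ] f a b)
  𝔼-∑ as bs f = trans (*-congˡ (∑-swap as bs f)) (*-∑ bs _ _)

  𝔼-swap : (as : List A) (bs : List B) (f : A → B → Carrier) →
           (𝔼[ a ← as ] 𝔼[ b ← bs ] f a b) ≈ (𝔼[ b ← bs ] 𝔼[ a ← as ] f a b)
  𝔼-swap as bs f = trans (sym (*-𝔼 as _ _)) (*-congˡ (𝔼-∑ as bs f))

  𝔼-productWith : (k : A → B → D) (as : List A) (bs : List B) (f : D → Carrier) →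
                  𝔼 (cartesianProductWith k as bs) f ≈ (𝔼[ a ← as ] 𝔼[ b ← bs ] f (k a b))
  𝔼-productWith k as bs f = begin
    recip (length (cartesianProductWith k as bs)) * ∑ (cartesianProductWith k as bs) f
      ≈⟨ *-cong (reflexive (≡.cong recip (length-productWith k as bs))) (∑-productWith k as bs f) ⟩
    recip (length as ℕ.* length bs) * (∑[ a ← as ] ∑[ b ← bs ] f (k a b))
      ≈⟨ *-congʳ (recip-* (length as) (length bs)) ⟩
    recip (length as) * recip (length bs) * (∑[ a ← as ] ∑[ b ← bs ] f (k a b))
      ≈⟨ *-assoc _ _ _ ⟩
    recip (length as) * (recip (length bs) * (∑[ a ← as ] ∑[ b ← bs ] f (k a b)))
      ≈⟨ *-congˡ (*-∑ as _ _) ⟩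
    (𝔼[ a ← as ] 𝔼[ b ← bs ] f (k a b)) ∎

  -- Opaque so that sums over it stay folded during unification.
  opaque
    signs : List Sign
    signs = Sign.+ ∷ Sign.- ∷ []

    𝔼-signs : (f : Sign → Carrier) → 𝔼 signs f ≈ recip 2 * (f Sign.+ + f Sign.-)
    𝔼-signs f = *-congˡ (+-congˡ (+-identityʳ _))

    𝔼-cube-suc : ∀ m (f : Cube (suc m) → Carrier) →
                 𝔼 (cube (suc m)) f ≈ (𝔼[ s ← signs ] 𝔼[ x ← cube m ] f (s ∷ x))
    𝔼-cube-suc m f = 𝔼-productWith _∷_ (Sign.+ ∷ Sign.- ∷ []) (cube m) f

  𝔼-cube-zero : (f : Cube 0 → Carrier) → 𝔼 (cube 0) f ≈ f []
  𝔼-cube-zero f = begin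
    recip 1 * (f [] + 0#)      ≈⟨ solve 2 (λ r c → r :* (c :+ con 0) := ((con 1 :+ con 0) :* r) :* c) refl _ _ ⟩
    1 · 1# * recip 1 * f []    ≈⟨ *-congʳ (recip-inverse 0) ⟩
    1# * f []                  ≈⟨ *-identityˡ _ ⟩
    f [] ∎

  2·½ : ∀ c → recip 2 * (c + c) ≈ c
  2·½ c = begin
    recip 2 * (c + c)       ≈⟨ solve 2 (λ h c → h :* (c :+ c) := ((con 1 :+ (con 1 :+ con 0)) :* h) :* c) refl _ _ ⟩
    2 · 1# * recip 2 * c    ≈⟨ *-congʳ (recip-inverse 1) ⟩
    1# * c                  ≈⟨ *-identityˡ c ⟩
    c ∎

  𝔼-signs-const : ∀ c → (𝔼[ s ← signs ] c) ≈ c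
  𝔼-signs-const c = trans (𝔼-signs _) (2·½ c)

  𝔼-cube-const : ∀ m c → (𝔼[ x ← cube m ] c) ≈ c
  𝔼-cube-const zero    c = 𝔼-cube-zero λ _ → c
  𝔼-cube-const (suc m) c = begin
    (𝔼[ x ← cube (suc m) ] c)           ≈⟨ 𝔼-cube-suc m _ ⟩
    (𝔼[ s ← signs ] 𝔼[ x ← cube m ] c) ≈⟨ 𝔼-cong signs (λ _ → 𝔼-cube-const m c) ⟩
    (𝔼[ s ← signs ] c)                  ≈⟨ 𝔼-signs-const c ⟩
    c                                   ∎

  -- Sign arithmetic and the delta kernel on the cube.

  ⟦⟧-homo : ∀ s t → ⟦ s Sign.* t ⟧ ≈ ⟦ s ⟧ * ⟦ t ⟧
  ⟦⟧-homo Sign.+ t      = sym (*-identityˡ _)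
  ⟦⟧-homo Sign.- Sign.+ = sym (*-identityʳ _)
  ⟦⟧-homo Sign.- Sign.- = begin
    1#            ≈⟨ -‿involutive 1# ⟨
    - (- 1#)      ≈⟨ -‿cong (*-identityˡ _) ⟨
    - (1# * - 1#) ≈⟨ -‿distribˡ-* 1# (- 1#) ⟩
    - 1# * - 1#   ∎

  ⟦⟧-square : ∀ s → ⟦ s ⟧ * ⟦ s ⟧ ≈ 1#
  ⟦⟧-square s = trans (sym (⟦⟧-homo s s)) (reflexive (≡.cong ⟦_⟧ (Sign.s*s≡+ s)))

  -- Twice the indicator of equality.
  agree : Sign → Sign → Carrier
  agree s t = 1# + ⟦ s ⟧ * ⟦ t ⟧

  agree-diag : ∀ s → agree s s ≈ 1# + 1#
  agree-diag s = +-congˡ (⟦⟧-square s)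

  agree-off : ∀ s t → s ≢ t → agree s t ≈ 0#
  agree-off Sign.+ Sign.+ s≢t = ⊥-elim (s≢t ≡.refl)
  agree-off Sign.- Sign.- s≢t = ⊥-elim (s≢t ≡.refl)
  agree-off Sign.+ Sign.- s≢t = trans (+-congˡ (*-identityˡ _)) (-‿inverseʳ 1#)
  agree-off Sign.- Sign.+ s≢t = trans (+-congˡ (*-identityʳ _)) (-‿inverseʳ 1#)

  agree-eval : ∀ s (f : Sign → Carrier) → (𝔼[ t ← signs ] agree s t * f t) ≈ f s
  agree-eval Sign.+ f = begin
    (𝔼[ t ← signs ] agree Sign.+ t * f t) ≈⟨ 𝔼-signs _ ⟩
    recip 2 * (agree Sign.+ Sign.+ * f Sign.+ + agree Sign.+ Sign.- * f Sign.-)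
      ≈⟨ *-congˡ (+-cong (*-congʳ (agree-diag Sign.+)) (*-congʳ (agree-off Sign.+ Sign.- λ ()))) ⟩
    recip 2 * ((1# + 1#) * f Sign.+ + 0# * f Sign.-)
      ≈⟨ solve 3 (λ h p q → h :* ((con 1 :+ con 1) :* p :+ con 0 :* q) := h :* (p :+ p)) refl _ _ _ ⟩
    recip 2 * (f Sign.+ + f Sign.+) ≈⟨ 2·½ _ ⟩
    f Sign.+ ∎
  agree-eval Sign.- f = begin
    (𝔼[ t ← signs ] agree Sign.- t * f t) ≈⟨ 𝔼-signs _ ⟩
    recip 2 * (agree Sign.- Sign.+ * f Sign.+ + agree Sign.- Sign.- * f Sign.-)
      ≈⟨ *-congˡ (+-cong (*-congʳ (agree-off Sign.- Sign.+ λ ())) (*-congʳ (agree-diag Sign.-))) ⟩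
    recip 2 * (0# * f Sign.+ + (1# + 1#) * f Sign.-)
      ≈⟨ solve 3 (λ h p q → h :* (con 0 :* p :+ (con 1 :+ con 1) :* q) := h :* (q :+ q)) refl _ _ _ ⟩
    recip 2 * (f Sign.- + f Sign.-) ≈⟨ 2·½ _ ⟩
    f Sign.- ∎

  -- The indicator of equality scaled by 2ⁿ, so that 𝔼[ z ] δ w z * f z = f w.
  δ : Cube n → Cube n → Carrier
  δ []      []      = 1#
  δ (s ∷ w) (t ∷ z) = agree s t * δ w z

  δ-eval : (w : Cube n) (f : Cube n → Carrier) → (𝔼[ z ← cube n ] δ w z * f z) ≈ f w
  δ-eval []      f = trans (𝔼-cube-zero λ z → δ [] z * f z) (*-identityˡ _)
  δ-eval {suc n} (s ∷ w) f = begin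
    (𝔼[ z ← cube (suc n) ] δ (s ∷ w) z * f z) ≈⟨ 𝔼-cube-suc n _ ⟩
    (𝔼[ t ← signs ] 𝔼[ z ← cube n ] agree s t * δ w z * f (t ∷ z))
      ≈⟨ 𝔼-cong signs (λ t → trans (𝔼-cong (cube n) λ z → *-assoc _ _ _) (sym (*-𝔼 (cube n) _ _))) ⟩
    (𝔼[ t ← signs ] agree s t * (𝔼[ z ← cube n ] δ w z * f (t ∷ z)))
      ≈⟨ 𝔼-cong signs (λ t → *-congˡ (δ-eval w _)) ⟩
    (𝔼[ t ← signs ] agree s t * f (t ∷ w)) ≈⟨ agree-eval s _ ⟩
    f (s ∷ w) ∎

  δ-off : (w z : Cube n) → w ≢ z → δ w z ≈ 0#
  δ-off []      []      w≢z = ⊥-elim (w≢z ≡.refl)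
  δ-off (s ∷ w) (t ∷ z) w≢z with s Sign.≟ t
  ... | no s≢t    = trans (*-congʳ (agree-off s t s≢t)) (zeroˡ _)
  ... | yes ≡.refl = trans (*-congˡ (δ-off w z λ w≡z → w≢z (≡.cong (s ∷_) w≡z))) (zeroʳ _)

  δ-diag : (z : Cube n) → δ z z ≈ length (cube n) · 1#
  δ-diag []      = sym (+-identityʳ 1#)
  δ-diag {suc n} (s ∷ z) = begin
    agree s s * δ z z                  ≈⟨ *-cong (agree-diag s) (δ-diag z) ⟩
    (1# + 1#) * length (cube n) · 1#   ≈⟨ *-congʳ (+-congˡ (+-identityʳ 1#)) ⟨
    2 · 1# * length (cube n) · 1#      ≈⟨ ×1-homo-* 2 (length (cube n)) ⟨
    (2 ℕ.* length (cube n)) · 1#       ≈⟨ reflexive (≡.cong (_· 1#) (length-productWith _∷_ (Sign.+ ∷ Sign.- ∷ []) (cube n))) ⟨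
    length (cube (suc n)) · 1#         ∎

  -- Trades a conditioned sum for a weighted sum over the whole list, where averages can be
  -- exchanged and factored block by block; c is k times the indicator of P.
  ∑-filter : {P : Pred A lzero} (P? : Decidable P) (as : List A) (c : A → Carrier) {k : Carrier} (f : A → Carrier) →
             (∀ a → P a → c a ≈ k) → (∀ a → ¬ P a → c a ≈ 0#) →
             k * ∑ (filter P? as) f ≈ (∑[ a ← as ] c a * f a)
  ∑-filter P? []       c f in-P out-P = zeroʳ _
  ∑-filter P? (a ∷ as) c {k} f in-P out-P with P? a
  ... | yes Pa = trans (distribˡ k _ _) (+-cong (*-congʳ (sym (in-P a Pa))) (∑-filter P? as c f in-P out-P))
  ... | no ¬Pa = trans (∑-filter P? as c f in-P out-P)
                   (trans (sym (+-identityˡ _)) (+-congʳ (sym (trans (*-congʳ (out-P a ¬Pa)) (zeroˡ _)))))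

  𝔼≈1⇒∑≈length : (as : List A) (f : A → Carrier) → 𝔼 as f ≈ 1# → ∑ as f ≈ length as · 1#
  𝔼≈1⇒∑≈length []          f e = refl
  𝔼≈1⇒∑≈length as@(_ ∷ bs) f e = begin
    ∑ as f                                          ≈⟨ *-identityˡ _ ⟨
    1# * ∑ as f                                     ≈⟨ *-congʳ (recip-inverse (length bs)) ⟨
    length as · 1# * recip (length as) * ∑ as f     ≈⟨ *-assoc _ _ _ ⟩
    length as · 1# * 𝔼 as f                         ≈⟨ *-congˡ e ⟩
    length as · 1# * 1#                             ≈⟨ *-identityʳ _ ⟩
    length as · 1#                                  ∎

  length-cube≉0 : ∀ n → ¬ (length (cube n) · 1# ≈ 0#)
  length-cube≉0 n e = 1≉0 (begin
    1#                                          ≈⟨ 𝔼-cube-const n 1# ⟨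
    recip (length (cube n)) * ∑ (cube n) _      ≈⟨ *-congˡ (trans (∑-one (cube n)) e) ⟩
    recip (length (cube n)) * 0#                ≈⟨ zeroʳ _ ⟩
    0#                                          ∎)

  -- Fourier coefficients of the fiber of a balanced gadget.

  𝔼-inputs-zero : ∀ m₁ m₂ (F : Inputs m₁ 0 → Inputs m₂ 0 → Carrier) →
                  𝔼 (inputs m₁ m₂ 0) (uncurry F) ≈ F [] []
  -- Both lists have exactly one element, so the two averages unfold to the same term.
  𝔼-inputs-zero m₁ m₂ F = 𝔼-cube-zero λ _ → F [] []

  -- `inputs` pairs all blocks of one player with all blocks of the other. Moving the first y-block
  -- past the remaining x-blocks brings the two first blocks together, so that block-by-block
  -- induction becomes possible.
  𝔼-inputs-suc : ∀ m₁ m₂ n (F : Inputs m₁ (suc n) → Inputs m₂ (suc n) → Carrier) →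
                 𝔼 (inputs m₁ m₂ (suc n)) (uncurry F) ≈
                 (𝔼[ x ← cube m₁ ] 𝔼[ y ← cube m₂ ]
                    𝔼 (inputs m₁ m₂ n) (uncurry λ xs ys → F (x ∷ xs) (y ∷ ys)))
  𝔼-inputs-suc m₁ m₂ n F = begin
    𝔼 (inputs m₁ m₂ (suc n)) (uncurry F)
      ≈⟨ 𝔼-productWith _,_ (words (cube m₁) (suc n)) (words (cube m₂) (suc n)) (uncurry F) ⟩
    (𝔼[ xs ← words (cube m₁) (suc n) ] 𝔼[ ys ← words (cube m₂) (suc n) ] F xs ys)
      ≈⟨ 𝔼-productWith _∷_ (cube m₁) (words (cube m₁) n) _ ⟩
    (𝔼[ x ← cube m₁ ] 𝔼[ xs ← words (cube m₁) n ] 𝔼[ ys ← words (cube m₂) (suc n) ] F (x ∷ xs) ys)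
      ≈⟨ 𝔼-cong (cube m₁) (λ x → 𝔼-cong (words (cube m₁) n) λ xs →
           𝔼-productWith _∷_ (cube m₂) (words (cube m₂) n) _) ⟩
    (𝔼[ x ← cube m₁ ] 𝔼[ xs ← words (cube m₁) n ] 𝔼[ y ← cube m₂ ] 𝔼[ ys ← words (cube m₂) n ] F (x ∷ xs) (y ∷ ys))
      ≈⟨ 𝔼-cong (cube m₁) (λ x → 𝔼-swap (words (cube m₁) n) (cube m₂) _) ⟩
    (𝔼[ x ← cube m₁ ] 𝔼[ y ← cube m₂ ] 𝔼[ xs ← words (cube m₁) n ] 𝔼[ ys ← words (cube m₂) n ] F (x ∷ xs) (y ∷ ys))
      ≈⟨ 𝔼-cong (cube m₁) (λ x → 𝔼-cong (cube m₂) λ y →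
           𝔼-productWith _,_ (words (cube m₁) n) (words (cube m₂) n) _) ⟨
    (𝔼[ x ← cube m₁ ] 𝔼[ y ← cube m₂ ] 𝔼 (inputs m₁ m₂ n) (uncurry λ xs ys → F (x ∷ xs) (y ∷ ys))) ∎

  -- This is ĝ(∅,∅) = 0: both values of g are equally likely on uniform inputs.
  Balanced : Gadget m₁ m₂ → Set ℓ
  Balanced {m₁} {m₂} g = (𝔼[ x ← cube m₁ ] 𝔼[ y ← cube m₂ ] ⟦ g x y ⟧) ≈ 0#

  module _ (g : Gadget m₁ m₂) (g-balanced : Balanced g) where

    𝔼-agree : ∀ t → (𝔼[ x ← cube m₁ ] 𝔼[ y ← cube m₂ ] agree (g x y) t) ≈ 1#
    𝔼-agree t = begin
      (𝔼[ x ← cube m₁ ] 𝔼[ y ← cube m₂ ] 1# + ⟦ g x y ⟧ * ⟦ t ⟧)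
        ≈⟨ 𝔼-cong (cube m₁) (λ x → trans (𝔼-+ (cube m₂) _ _)
             (+-cong (𝔼-cube-const m₂ 1#) (sym (𝔼-* (cube m₂) ⟦ t ⟧ _)))) ⟩
      (𝔼[ x ← cube m₁ ] 1# + (𝔼[ y ← cube m₂ ] ⟦ g x y ⟧) * ⟦ t ⟧)
        ≈⟨ trans (𝔼-+ (cube m₁) _ _) (+-cong (𝔼-cube-const m₁ 1#) (sym (𝔼-* (cube m₁) ⟦ t ⟧ _))) ⟩
      1# + (𝔼[ x ← cube m₁ ] 𝔼[ y ← cube m₂ ] ⟦ g x y ⟧) * ⟦ t ⟧
        ≈⟨ +-congˡ (trans (*-congʳ g-balanced) (zeroˡ _)) ⟩
      1# + 0# ≈⟨ +-identityʳ 1# ⟩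
      1# ∎

    -- The values g(x_i, y_i) are independent uniform signs, so every z has probability 2⁻ⁿ, which
    -- cancels the factor 2ⁿ in `δ`.
    𝔼-δ : (z : Cube n) → 𝔼 (inputs m₁ m₂ n) (uncurry λ xs ys → δ (zipWith g xs ys) z) ≈ 1#
    𝔼-δ []      = 𝔼-inputs-zero m₁ m₂ λ xs ys → δ (zipWith g xs ys) []
    𝔼-δ {suc n} (t ∷ z) = begin
      𝔼 (inputs m₁ m₂ (suc n)) (uncurry λ xs ys → δ (zipWith g xs ys) (t ∷ z))
        ≈⟨ 𝔼-inputs-suc m₁ m₂ n _ ⟩
      (𝔼[ x ← cube m₁ ] 𝔼[ y ← cube m₂ ]
         𝔼 (inputs m₁ m₂ n) (uncurry λ xs ys → agree (g x y) t * δ (zipWith g xs ys) z))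
        ≈⟨ 𝔼-cong (cube m₁) (λ x → 𝔼-cong (cube m₂) λ y →
             trans (sym (*-𝔼 (inputs m₁ m₂ n) _ _)) (trans (*-congˡ (𝔼-δ z)) (*-identityʳ _))) ⟩
      (𝔼[ x ← cube m₁ ] 𝔼[ y ← cube m₂ ] agree (g x y) t) ≈⟨ 𝔼-agree t ⟩
      1# ∎

    -- Since each z has probability 2⁻ⁿ, dividing by the probability of the conditioning event is
    -- exactly the normalisation built into `δ`.
    fiber-δ : (C : RandomizedProtocol (Inputs m₁ n) (Inputs m₂ n) d) (z : Cube n) →
              fiber g C z ≈ 𝔼 (inputs m₁ m₂ n) (uncurry λ xs ys → δ (zipWith g xs ys) z * value C xs ys)
    fiber-δ {n} C z = begin
      recip ∣pre∣ * ∑ (preimage g z) (uncurry (value C))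
        ≈⟨ *-congʳ (recip-quotient ∣cube∣ ∣pre∣ ∣inputs∣ (length-cube≉0 n) sizes) ⟩
      ∣cube∣ · 1# * recip ∣inputs∣ * ∑ (preimage g z) (uncurry (value C))
        ≈⟨ solve 3 (λ a r s → a :* r :* s := r :* (a :* s)) refl _ _ _ ⟩
      recip ∣inputs∣ * (∣cube∣ · 1# * ∑ (preimage g z) (uncurry (value C)))
        ≈⟨ *-congˡ (∑-preimage (uncurry (value C))) ⟩
      𝔼 (inputs m₁ m₂ n) (uncurry λ xs ys → δ (zipWith g xs ys) z * value C xs ys) ∎
      where
      ∣pre∣ ∣cube∣ ∣inputs∣ : ℕ
      ∣pre∣    = length (preimage g z)
      ∣cube∣   = length (cube n)
      ∣inputs∣ = length (inputs m₁ m₂ n)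

      ∑-preimage : ∀ f → ∣cube∣ · 1# * ∑ (preimage g z) f ≈
                   (∑ (inputs m₁ m₂ n) λ (xs , ys) → δ (zipWith g xs ys) z * f (xs , ys))
      ∑-preimage f = ∑-filter _ (inputs m₁ m₂ n) _ f
        (λ { (xs , ys) ≡.refl → δ-diag (zipWith g xs ys) })
        (λ (xs , ys) → δ-off (zipWith g xs ys) z)

      sizes : ∣cube∣ · 1# * ∣pre∣ · 1# ≈ ∣inputs∣ · 1#
      sizes = begin
        -- The same conversion applied to the constant 1 counts the preimage.
        ∣cube∣ · 1# * ∣pre∣ · 1#                      ≈⟨ *-congˡ (∑-one (preimage g z)) ⟨
        ∣cube∣ · 1# * (∑[ _ ← preimage g z ] 1#)      ≈⟨ ∑-preimage (λ _ → 1#) ⟩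
        (∑ (inputs m₁ m₂ n) λ (xs , ys) → δ (zipWith g xs ys) z * 1#)
          ≈⟨ ∑-cong (inputs m₁ m₂ n) (λ _ → *-identityʳ _) ⟩
        (∑ (inputs m₁ m₂ n) λ (xs , ys) → δ (zipWith g xs ys) z)
          ≈⟨ 𝔼≈1⇒∑≈length (inputs m₁ m₂ n) _ (𝔼-δ z) ⟩
        ∣inputs∣ · 1#                                 ∎

    -- Averaging over uniform z after conditioning on z is the unconditional average, because z =
    -- g(x, y) is itself uniform. Formally, exchanging the averages lets `δ` substitute g(x, y) for
    -- z.
    fourier-fiber : (C : RandomizedProtocol (Inputs m₁ n) (Inputs m₂ n) d) (I : Subset n) →
                    fourier (fiber g C) I ≈
                    𝔼 (inputs m₁ m₂ n) (uncurry λ xs ys → value C xs ys * ⟦ χ I (zipWith g xs ys) ⟧)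
    fourier-fiber {n} C I = begin
      (𝔼[ z ← cube n ] fiber g C z * ⟦ χ I z ⟧)
        ≈⟨ 𝔼-cong (cube n) (λ z → trans (*-congʳ (fiber-δ C z)) (𝔼-* (inputs m₁ m₂ n) _ _)) ⟩
      (𝔼[ z ← cube n ] 𝔼 (inputs m₁ m₂ n) λ (xs , ys) → δ (zipWith g xs ys) z * value C xs ys * ⟦ χ I z ⟧)
        ≈⟨ 𝔼-swap (cube n) (inputs m₁ m₂ n) _ ⟩
      (𝔼 (inputs m₁ m₂ n) λ (xs , ys) → 𝔼[ z ← cube n ] δ (zipWith g xs ys) z * value C xs ys * ⟦ χ I z ⟧)
        ≈⟨ 𝔼-cong (inputs m₁ m₂ n) (λ (xs , ys) →
             trans (𝔼-cong (cube n) λ z → *-assoc _ _ _) (δ-eval (zipWith g xs ys) _)) ⟩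
      𝔼 (inputs m₁ m₂ n) (uncurry λ xs ys → value C xs ys * ⟦ χ I (zipWith g xs ys) ⟧) ∎

  -- Fourier inversion and Parseval for gadgets.

  ∑-subsets-suc : ∀ m (f : Subset (suc m) → Carrier) →
                  ∑ (subsets (suc m)) f ≈ (∑[ S ← subsets m ] f (inside ∷ S) + f (outside ∷ S))
  ∑-subsets-suc m f = trans (∑-productWith _∷_ (inside ∷ outside ∷ []) (subsets m) f)
    (trans (+-congˡ (+-identityʳ _)) (sym (∑-+ (subsets m) _ _)))

  fourier-inside : (f : Cube (suc m) → Carrier) (S : Subset m) →
                   fourier f (inside ∷ S) ≈ (𝔼[ t ← signs ] ⟦ t ⟧ * fourier (λ x → f (t ∷ x)) S)
  fourier-inside {m} f S = trans (𝔼-cube-suc m _) (𝔼-cong signs λ t →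
    trans (𝔼-cong (cube m) λ x → trans (*-congˡ (⟦⟧-homo t (χ S x)))
      (solve 3 (λ a b c → a :* (b :* c) := b :* (a :* c)) refl _ _ _)) (sym (*-𝔼 (cube m) _ _)))

  -- Induction on coordinates. The two subsets that differ only in the first coordinate contribute
  -- together the kernel 1 + s t, which evaluates a function of t at s.
  fourier-inversion : (f : Cube m → Carrier) (x : Cube m) →
                      (∑[ S ← subsets m ] ⟦ χ S x ⟧ * fourier f S) ≈ f x
  fourier-inversion f [] = begin
    1# * fourier f [] + 0#      ≈⟨ trans (+-identityʳ _) (*-identityˡ _) ⟩
    fourier f []                ≈⟨ 𝔼-cube-zero (λ z → f z * ⟦ χ [] z ⟧) ⟩
    f [] * 1#                   ≈⟨ *-identityʳ _ ⟩
    f []                        ∎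
  fourier-inversion {suc m} f (s ∷ x) = begin
    (∑[ S ← subsets (suc m) ] ⟦ χ S (s ∷ x) ⟧ * fourier f S)
      ≈⟨ ∑-subsets-suc m _ ⟩
    (∑[ S ← subsets m ] ⟦ s Sign.* χ S x ⟧ * fourier f (inside ∷ S) + ⟦ χ S x ⟧ * fourier f (outside ∷ S))
      ≈⟨ ∑-cong (subsets m) merge ⟩
    (∑[ S ← subsets m ] 𝔼[ t ← signs ] agree s t * (⟦ χ S x ⟧ * fourier (λ x → f (t ∷ x)) S))
      ≈⟨ 𝔼-∑ signs (subsets m) _ ⟨
    (𝔼[ t ← signs ] ∑[ S ← subsets m ] agree s t * (⟦ χ S x ⟧ * fourier (λ x → f (t ∷ x)) S))
      ≈⟨ 𝔼-cong signs (λ t → trans (sym (*-∑ (subsets m) _ _)) (*-congˡ (fourier-inversion (λ x → f (t ∷ x)) x))) ⟩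
    (𝔼[ t ← signs ] agree s t * f (t ∷ x))
      ≈⟨ agree-eval s (λ t → f (t ∷ x)) ⟩
    f (s ∷ x) ∎
    where
    merge : ∀ S → ⟦ s Sign.* χ S x ⟧ * fourier f (inside ∷ S) + ⟦ χ S x ⟧ * fourier f (outside ∷ S) ≈
                  (𝔼[ t ← signs ] agree s t * (⟦ χ S x ⟧ * fourier (λ x → f (t ∷ x)) S))
    merge S = begin
      ⟦ s Sign.* χ S x ⟧ * fourier f (inside ∷ S) + ⟦ χ S x ⟧ * fourier f (outside ∷ S)
        ≈⟨ +-cong (*-cong (⟦⟧-homo s (χ S x)) (fourier-inside f S)) (*-congˡ (𝔼-cube-suc m _)) ⟩
      ⟦ s ⟧ * ⟦ χ S x ⟧ * (𝔼[ t ← signs ] ⟦ t ⟧ * φ t) + ⟦ χ S x ⟧ * (𝔼[ t ← signs ] φ t)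
        ≈⟨ +-cong (*-𝔼 signs _ _) (*-𝔼 signs _ _) ⟩
      (𝔼[ t ← signs ] ⟦ s ⟧ * ⟦ χ S x ⟧ * (⟦ t ⟧ * φ t)) + (𝔼[ t ← signs ] ⟦ χ S x ⟧ * φ t)
        ≈⟨ 𝔼-+ signs _ _ ⟨
      (𝔼[ t ← signs ] ⟦ s ⟧ * ⟦ χ S x ⟧ * (⟦ t ⟧ * φ t) + ⟦ χ S x ⟧ * φ t)
        ≈⟨ 𝔼-cong signs (λ t →
             solve 4 (λ s c t f → s :* c :* (t :* f) :+ c :* f := (con 1 :+ s :* t) :* (c :* f))
               refl ⟦ s ⟧ ⟦ χ S x ⟧ ⟦ t ⟧ (φ t)) ⟩
      (𝔼[ t ← signs ] agree s t * (⟦ χ S x ⟧ * φ t)) ∎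
      where
      φ : Sign → Carrier
      φ t = fourier (λ x → f (t ∷ x)) S

  module _ (g : Gadget m₁ m₂) where

    gadgetFourier-𝔼 : ∀ S T → gadgetFourier g S T ≈
      (𝔼[ x ← cube m₁ ] 𝔼[ y ← cube m₂ ] ⟦ g x y ⟧ * (⟦ χ S x ⟧ * ⟦ χ T y ⟧))
    gadgetFourier-𝔼 S T = trans (𝔼-productWith _,_ (cube m₁) (cube m₂) _)
      (𝔼-cong (cube m₁) λ x → 𝔼-cong (cube m₂) λ y → *-assoc _ _ _)

    -- Presents the two-sided transform as two one-sided ones, so that the inversion formula can be
    -- applied once per player.
    gadgetFourier-fourier : ∀ S T → gadgetFourier g S T ≈ fourier (λ y → fourier (λ x → ⟦ g x y ⟧) S) T
    gadgetFourier-fourier S T = begin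
      gadgetFourier g S T
        ≈⟨ 𝔼-productWith _,_ (cube m₁) (cube m₂) _ ⟩
      (𝔼[ x ← cube m₁ ] 𝔼[ y ← cube m₂ ] ⟦ g x y ⟧ * ⟦ χ S x ⟧ * ⟦ χ T y ⟧)
        ≈⟨ 𝔼-swap (cube m₁) (cube m₂) _ ⟩
      (𝔼[ y ← cube m₂ ] 𝔼[ x ← cube m₁ ] ⟦ g x y ⟧ * ⟦ χ S x ⟧ * ⟦ χ T y ⟧)
        ≈⟨ 𝔼-cong (cube m₂) (λ y → 𝔼-* (cube m₁) _ _) ⟨
      fourier (λ y → fourier (λ x → ⟦ g x y ⟧) S) T ∎

    gadget-inversion : ∀ x y →
      (∑[ S ← subsets m₁ ] ∑[ T ← subsets m₂ ] gadgetFourier g S T * (⟦ χ S x ⟧ * ⟦ χ T y ⟧)) ≈ ⟦ g x y ⟧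
    gadget-inversion x y = begin
      (∑[ S ← subsets m₁ ] ∑[ T ← subsets m₂ ] gadgetFourier g S T * (⟦ χ S x ⟧ * ⟦ χ T y ⟧))
        ≈⟨ ∑-cong (subsets m₁) (λ S → ∑-cong (subsets m₂) λ T →
             trans (*-congʳ (gadgetFourier-fourier S T))
               (solve 3 (λ a b c → a :* (b :* c) := b :* (c :* a)) refl _ _ _)) ⟩
      (∑[ S ← subsets m₁ ] ∑[ T ← subsets m₂ ]
         ⟦ χ S x ⟧ * (⟦ χ T y ⟧ * fourier (λ y → fourier (λ x → ⟦ g x y ⟧) S) T))
        ≈⟨ ∑-cong (subsets m₁) (λ S → trans (sym (*-∑ (subsets m₂) _ _))
             (*-congˡ (fourier-inversion (λ y → fourier (λ x → ⟦ g x y ⟧) S) y))) ⟩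
      (∑[ S ← subsets m₁ ] ⟦ χ S x ⟧ * fourier (λ x → ⟦ g x y ⟧) S)
        ≈⟨ fourier-inversion (λ x → ⟦ g x y ⟧) x ⟩
      ⟦ g x y ⟧ ∎

    gadget-expansion : (F : Cube m₁ → Cube m₂ → Carrier) →
      (𝔼[ x ← cube m₁ ] 𝔼[ y ← cube m₂ ] F x y * ⟦ g x y ⟧) ≈
      (∑[ S ← subsets m₁ ] ∑[ T ← subsets m₂ ] gadgetFourier g S T *
         (𝔼[ x ← cube m₁ ] 𝔼[ y ← cube m₂ ] F x y * (⟦ χ S x ⟧ * ⟦ χ T y ⟧)))
    gadget-expansion F = begin
      (𝔼[ x ← cube m₁ ] 𝔼[ y ← cube m₂ ] F x y * ⟦ g x y ⟧)
        ≈⟨ 𝔼-cong (cube m₁) (λ x → 𝔼-cong (cube m₂) λ y →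
             trans (*-congˡ (sym (gadget-inversion x y)))
               (trans (*-∑ (subsets m₁) _ _) (∑-cong (subsets m₁) λ S → *-∑ (subsets m₂) _ _))) ⟩
      (𝔼[ x ← cube m₁ ] 𝔼[ y ← cube m₂ ] ∑[ S ← subsets m₁ ] ∑[ T ← subsets m₂ ]
         F x y * (gadgetFourier g S T * (⟦ χ S x ⟧ * ⟦ χ T y ⟧)))
        ≈⟨ 𝔼-cong (cube m₁) (λ x → trans (𝔼-∑ (cube m₂) (subsets m₁) _)
             (∑-cong (subsets m₁) λ S → 𝔼-∑ (cube m₂) (subsets m₂) _)) ⟩
      (𝔼[ x ← cube m₁ ] ∑[ S ← subsets m₁ ] ∑[ T ← subsets m₂ ] 𝔼[ y ← cube m₂ ]
         F x y * (gadgetFourier g S T * (⟦ χ S x ⟧ * ⟦ χ T y ⟧)))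
        ≈⟨ trans (𝔼-∑ (cube m₁) (subsets m₁) _) (∑-cong (subsets m₁) λ S → 𝔼-∑ (cube m₁) (subsets m₂) _) ⟩
      (∑[ S ← subsets m₁ ] ∑[ T ← subsets m₂ ] 𝔼[ x ← cube m₁ ] 𝔼[ y ← cube m₂ ]
         F x y * (gadgetFourier g S T * (⟦ χ S x ⟧ * ⟦ χ T y ⟧)))
        ≈⟨ ∑-cong (subsets m₁) (λ S → ∑-cong (subsets m₂) λ T →
             trans (𝔼-cong (cube m₁) λ x → trans (𝔼-cong (cube m₂) λ y →
               solve 3 (λ a b c → a :* (b :* c) := b :* (a :* c)) refl _ _ _)
               (sym (*-𝔼 (cube m₂) _ _))) (sym (*-𝔼 (cube m₁) _ _))) ⟩
      (∑[ S ← subsets m₁ ] ∑[ T ← subsets m₂ ] gadgetFourier g S T *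
         (𝔼[ x ← cube m₁ ] 𝔼[ y ← cube m₂ ] F x y * (⟦ χ S x ⟧ * ⟦ χ T y ⟧))) ∎

    -- The expansion of g paired with F = g, together with g² = 1.
    parseval : (∑[ S ← subsets m₁ ] ∑[ T ← subsets m₂ ] gadgetFourier g S T * gadgetFourier g S T) ≈ 1#
    parseval = begin
      (∑[ S ← subsets m₁ ] ∑[ T ← subsets m₂ ] gadgetFourier g S T * gadgetFourier g S T)
        ≈⟨ ∑-cong (subsets m₁) (λ S → ∑-cong (subsets m₂) λ T → *-congˡ (gadgetFourier-𝔼 S T)) ⟩
      (∑[ S ← subsets m₁ ] ∑[ T ← subsets m₂ ] gadgetFourier g S T *
         (𝔼[ x ← cube m₁ ] 𝔼[ y ← cube m₂ ] ⟦ g x y ⟧ * (⟦ χ S x ⟧ * ⟦ χ T y ⟧)))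
        ≈⟨ gadget-expansion (λ x y → ⟦ g x y ⟧) ⟨
      (𝔼[ x ← cube m₁ ] 𝔼[ y ← cube m₂ ] ⟦ g x y ⟧ * ⟦ g x y ⟧)
        ≈⟨ 𝔼-cong (cube m₁) (λ x → trans (𝔼-cong (cube m₂) λ y → ⟦⟧-square (g x y)) (𝔼-cube-const m₂ 1#)) ⟩
      (𝔼[ x ← cube m₁ ] 1#)
        ≈⟨ 𝔼-cube-const m₁ 1# ⟩
      1# ∎

  -- Planting a sign in a uniform point.

  shift : Subset m → Sign → Cube m → Cube m
  shift []            s []      = []
  shift (inside  ∷ S) s (t ∷ x) = s Sign.* t ∷ x
  shift (outside ∷ S) s (t ∷ x) = t ∷ shift S s x

  -- The changed coordinate is the first one in S, which occurs once in the product `χ S`. For S =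
  -- `⊥` nothing is changed and no sign can be planted.
  χ-shift : (S : Subset m) → S ≢ ⊥ → ∀ s x → χ S (shift S s x) ≡ s Sign.* χ S x
  χ-shift []            S≢⊥ s []      = ⊥-elim (S≢⊥ ≡.refl)
  χ-shift (inside  ∷ S) S≢⊥ s (t ∷ x) = Sign.*-assoc s t (χ S x)
  χ-shift (outside ∷ S) S≢⊥ s (t ∷ x) = χ-shift S (λ S≡⊥ → S≢⊥ (≡.cong (outside ∷_) S≡⊥)) s x

  𝔼-signs-shift : ∀ s (f : Sign → Carrier) → (𝔼[ t ← signs ] f (s Sign.* t)) ≈ 𝔼 signs f
  𝔼-signs-shift Sign.+ f = refl
  𝔼-signs-shift Sign.- f = trans (𝔼-signs _) (trans (*-congˡ (+-comm _ _)) (sym (𝔼-signs f)))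

  -- For a fixed sign, `shift` is a bijection of the cube.
  𝔼-shift : (S : Subset m) (s : Sign) (f : Cube m → Carrier) →
            (𝔼[ x ← cube m ] f (shift S s x)) ≈ 𝔼 (cube m) f
  𝔼-shift []            s f = trans (𝔼-cube-zero λ x → f (shift [] s x)) (sym (𝔼-cube-zero f))
  𝔼-shift {suc m} (inside ∷ S) s f = begin
    (𝔼[ x ← cube (suc m) ] f (shift (inside ∷ S) s x))        ≈⟨ 𝔼-cube-suc m _ ⟩
    (𝔼[ t ← signs ] 𝔼[ x ← cube m ] f (s Sign.* t ∷ x))      ≈⟨ 𝔼-signs-shift s (λ t → 𝔼[ x ← cube m ] f (t ∷ x)) ⟩
    (𝔼[ t ← signs ] 𝔼[ x ← cube m ] f (t ∷ x))               ≈⟨ 𝔼-cube-suc m f ⟨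
    𝔼 (cube (suc m)) f                                        ∎
  𝔼-shift {suc m} (outside ∷ S) s f = begin
    (𝔼[ x ← cube (suc m) ] f (shift (outside ∷ S) s x))       ≈⟨ 𝔼-cube-suc m _ ⟩
    (𝔼[ t ← signs ] 𝔼[ x ← cube m ] f (t ∷ shift S s x))     ≈⟨ 𝔼-cong signs (λ t → 𝔼-shift S s (λ x → f (t ∷ x))) ⟩
    (𝔼[ t ← signs ] 𝔼[ x ← cube m ] f (t ∷ x))               ≈⟨ 𝔼-cube-suc m f ⟨
    𝔼 (cube (suc m)) f                                        ∎

  module _ {p : ℕ} (σ : Cube p → Sign) where

    -- The mask u hides the planted sign: for each fixed a the shifted point is already uniform.
    𝔼-pull : (S : Subset m) (f : Cube m → Carrier) →
             (𝔼[ u ← cube m ] 𝔼[ a ← cube p ] f (shift S (σ a) u)) ≈ 𝔼 (cube m) f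
    𝔼-pull {m} S f = begin
      (𝔼[ u ← cube m ] 𝔼[ a ← cube p ] f (shift S (σ a) u)) ≈⟨ 𝔼-swap (cube m) (cube p) _ ⟩
      (𝔼[ a ← cube p ] 𝔼[ u ← cube m ] f (shift S (σ a) u)) ≈⟨ 𝔼-cong (cube p) (λ a → 𝔼-shift S (σ a) f) ⟩
      (𝔼[ a ← cube p ] 𝔼 (cube m) f)                        ≈⟨ 𝔼-cube-const p _ ⟩
      𝔼 (cube m) f                                          ∎

    -- The planted sign is recovered as σ(a) = χ_S(u) χ_S(x), where x is the shifted point. The
    -- factor χ_S(u) depends on the mask alone, so it can be moved into the coefficient of the
    -- random choice.
    𝔼-pull-χ : (S : Subset m) → S ≢ ⊥ → (f : Cube m → Carrier) →
               (𝔼[ u ← cube m ] ⟦ χ S u ⟧ * (𝔼[ a ← cube p ] f (shift S (σ a) u) * ⟦ σ a ⟧)) ≈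
               (𝔼[ x ← cube m ] f x * ⟦ χ S x ⟧)
    𝔼-pull-χ {m} S S≢⊥ f = begin
      (𝔼[ u ← cube m ] ⟦ χ S u ⟧ * (𝔼[ a ← cube p ] f (shift S (σ a) u) * ⟦ σ a ⟧))
        ≈⟨ 𝔼-cong (cube m) (λ u → trans (*-𝔼 (cube p) _ _) (𝔼-cong (cube p) λ a → absorb u a)) ⟩
      (𝔼[ u ← cube m ] 𝔼[ a ← cube p ] f (shift S (σ a) u) * ⟦ χ S (shift S (σ a) u) ⟧)
        ≈⟨ 𝔼-pull S (λ x → f x * ⟦ χ S x ⟧) ⟩
      (𝔼[ x ← cube m ] f x * ⟦ χ S x ⟧) ∎
      where
      absorb : ∀ u a → ⟦ χ S u ⟧ * (f (shift S (σ a) u) * ⟦ σ a ⟧) ≈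
                       f (shift S (σ a) u) * ⟦ χ S (shift S (σ a) u) ⟧
      absorb u a = begin
        ⟦ χ S u ⟧ * (f (shift S (σ a) u) * ⟦ σ a ⟧)
          ≈⟨ solve 3 (λ c f s → c :* (f :* s) := f :* (s :* c)) refl _ _ _ ⟩
        f (shift S (σ a) u) * (⟦ σ a ⟧ * ⟦ χ S u ⟧)
          ≈⟨ *-congˡ (⟦⟧-homo (σ a) (χ S u)) ⟨
        f (shift S (σ a) u) * ⟦ σ a Sign.* χ S u ⟧
          ≈⟨ *-congˡ (reflexive (≡.cong ⟦_⟧ (χ-shift S S≢⊥ (σ a) u))) ⟨
        f (shift S (σ a) u) * ⟦ χ S (shift S (σ a) u) ⟧ ∎

    𝔼-pull₂ : (S : Subset m₁) (T : Subset m₂) (F : Cube m₁ → Cube m₂ → Carrier) →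
              (𝔼[ u ← cube m₁ ] 𝔼[ v ← cube m₂ ] 𝔼[ a ← cube p ] 𝔼[ b ← cube p ]
                 F (shift S (σ a) u) (shift T (σ b) v)) ≈
              (𝔼[ x ← cube m₁ ] 𝔼[ y ← cube m₂ ] F x y)
    𝔼-pull₂ {m₁} {m₂} S T F = begin
      (𝔼[ u ← cube m₁ ] 𝔼[ v ← cube m₂ ] 𝔼[ a ← cube p ] 𝔼[ b ← cube p ]
         F (shift S (σ a) u) (shift T (σ b) v))
        ≈⟨ 𝔼-cong (cube m₁) (λ u → trans (𝔼-swap (cube m₂) (cube p) _)
             (𝔼-cong (cube p) λ a → 𝔼-pull T (F (shift S (σ a) u)))) ⟩
      (𝔼[ u ← cube m₁ ] 𝔼[ a ← cube p ] 𝔼[ y ← cube m₂ ] F (shift S (σ a) u) y)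
        ≈⟨ 𝔼-pull S (λ x → 𝔼[ y ← cube m₂ ] F x y) ⟩
      (𝔼[ x ← cube m₁ ] 𝔼[ y ← cube m₂ ] F x y) ∎

    -- Because the sign seen by the gadget factors as σ(a) σ(b), the one-player identity applies to
    -- y with the shifted x fixed, and then to x with y averaged out.
    𝔼-pull₂-χ : (S : Subset m₁) (T : Subset m₂) → S ≢ ⊥ → T ≢ ⊥ → (F : Cube m₁ → Cube m₂ → Carrier) →
                (𝔼[ u ← cube m₁ ] 𝔼[ v ← cube m₂ ] ⟦ χ S u ⟧ * ⟦ χ T v ⟧ *
                   (𝔼[ a ← cube p ] 𝔼[ b ← cube p ] F (shift S (σ a) u) (shift T (σ b) v) * ⟦ σ a Sign.* σ b ⟧)) ≈
                (𝔼[ x ← cube m₁ ] 𝔼[ y ← cube m₂ ] F x y * (⟦ χ S x ⟧ * ⟦ χ T y ⟧))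
    𝔼-pull₂-χ {m₁} {m₂} S T S≢⊥ T≢⊥ F = begin
      (𝔼[ u ← cube m₁ ] 𝔼[ v ← cube m₂ ] ⟦ χ S u ⟧ * ⟦ χ T v ⟧ *
         (𝔼[ a ← cube p ] 𝔼[ b ← cube p ] F (shift S (σ a) u) (shift T (σ b) v) * ⟦ σ a Sign.* σ b ⟧))
        ≈⟨ 𝔼-cong (cube m₁) inner ⟩
      (𝔼[ u ← cube m₁ ] ⟦ χ S u ⟧ * (𝔼[ a ← cube p ] G (shift S (σ a) u) * ⟦ σ a ⟧))
        ≈⟨ 𝔼-pull-χ S S≢⊥ G ⟩
      (𝔼[ x ← cube m₁ ] G x * ⟦ χ S x ⟧)
        ≈⟨ 𝔼-cong (cube m₁) (λ x → trans (𝔼-* (cube m₂) _ _) (𝔼-cong (cube m₂) λ y →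
             solve 3 (λ f t s → f :* t :* s := f :* (s :* t)) refl _ _ _)) ⟩
      (𝔼[ x ← cube m₁ ] 𝔼[ y ← cube m₂ ] F x y * (⟦ χ S x ⟧ * ⟦ χ T y ⟧)) ∎
      where
      G : Cube m₁ → Carrier
      G x = 𝔼[ y ← cube m₂ ] F x y * ⟦ χ T y ⟧

      inner : ∀ u →
        (𝔼[ v ← cube m₂ ] ⟦ χ S u ⟧ * ⟦ χ T v ⟧ *
           (𝔼[ a ← cube p ] 𝔼[ b ← cube p ] F (shift S (σ a) u) (shift T (σ b) v) * ⟦ σ a Sign.* σ b ⟧)) ≈
        ⟦ χ S u ⟧ * (𝔼[ a ← cube p ] G (shift S (σ a) u) * ⟦ σ a ⟧)
      inner u = begin
        (𝔼[ v ← cube m₂ ] ⟦ χ S u ⟧ * ⟦ χ T v ⟧ *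
           (𝔼[ a ← cube p ] 𝔼[ b ← cube p ] F (shift S (σ a) u) (shift T (σ b) v) * ⟦ σ a Sign.* σ b ⟧))
          ≈⟨ 𝔼-cong (cube m₂) (λ v → trans (*-assoc _ _ _) (*-congˡ (*-congˡ (𝔼-cong (cube p) λ a →
               trans (𝔼-cong (cube p) λ b → trans (*-congˡ (trans (⟦⟧-homo (σ a) (σ b)) (*-comm _ _)))
                 (sym (*-assoc _ _ _))) (sym (𝔼-* (cube p) _ _)))))) ⟩
        (𝔼[ v ← cube m₂ ] ⟦ χ S u ⟧ * (⟦ χ T v ⟧ *
           (𝔼[ a ← cube p ] (𝔼[ b ← cube p ] F (shift S (σ a) u) (shift T (σ b) v) * ⟦ σ b ⟧) * ⟦ σ a ⟧)))
          ≈⟨ *-𝔼 (cube m₂) _ _ ⟨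
        ⟦ χ S u ⟧ * (𝔼[ v ← cube m₂ ] ⟦ χ T v ⟧ *
           (𝔼[ a ← cube p ] (𝔼[ b ← cube p ] F (shift S (σ a) u) (shift T (σ b) v) * ⟦ σ b ⟧) * ⟦ σ a ⟧))
          ≈⟨ *-congˡ (𝔼-cong (cube m₂) λ v → trans (*-𝔼 (cube p) _ _)
               (𝔼-cong (cube p) λ a → sym (*-assoc _ _ _))) ⟩
        ⟦ χ S u ⟧ * (𝔼[ v ← cube m₂ ] 𝔼[ a ← cube p ] ⟦ χ T v ⟧ *
           (𝔼[ b ← cube p ] F (shift S (σ a) u) (shift T (σ b) v) * ⟦ σ b ⟧) * ⟦ σ a ⟧)
          ≈⟨ *-congˡ (𝔼-swap (cube m₂) (cube p) _) ⟩
        ⟦ χ S u ⟧ * (𝔼[ a ← cube p ] 𝔼[ v ← cube m₂ ] ⟦ χ T v ⟧ *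
           (𝔼[ b ← cube p ] F (shift S (σ a) u) (shift T (σ b) v) * ⟦ σ b ⟧) * ⟦ σ a ⟧)
          ≈⟨ *-congˡ (𝔼-cong (cube p) λ a → trans (sym (𝔼-* (cube m₂) _ _))
               (*-congʳ (𝔼-pull-χ T T≢⊥ (F (shift S (σ a) u))))) ⟩
        ⟦ χ S u ⟧ * (𝔼[ a ← cube p ] G (shift S (σ a) u) * ⟦ σ a ⟧) ∎

  -- Order and absolute values.

  ∣∣-nonNeg : ∀ x → 0# ≤ ∣ x ∣
  ∣∣-nonNeg x with ≤-total 0# x
  ... | inj₁ 0≤x = ≤-trans 0≤x (x≤x⊔y x (- x))
  ... | inj₂ x≤0 = ≤-trans (x≤0⇒0≤-x x≤0) (x≤y⊔x x (- x))

  ∣∣x∣∣≤∣x∣ : ∀ x → ∣ ∣ x ∣ ∣ ≤ ∣ x ∣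
  ∣∣x∣∣≤∣x∣ x = ⊔-lub ≤-refl (0≤y-x⇒x≤y (≤-respʳ (+-congˡ (sym (-‿involutive _)))
    (≤-respˡ (+-identityˡ 0#) (+-mono-≤ (∣∣-nonNeg x) (∣∣-nonNeg x)))))

  ∣x*y∣≤ : ∀ x y → ∣ x * y ∣ ≤ ∣ x ∣ * ∣ y ∣
  ∣x*y∣≤ x y with ⊔-sel x (- x)
  ... | inj₁ ∣x∣≈x  = ≤-respʳ (*-congʳ (sym ∣x∣≈x)) (∣w*x∣≤ y (≤-respʳ ∣x∣≈x (∣∣-nonNeg x)))
  ... | inj₂ ∣x∣≈-x = ≤-respˡ (∣∣-cong (trans (-‿cong (sym (-‿distribˡ-* x y))) (-‿involutive _)))
    (≤-trans (∣-x∣≤ (- x * y)) (≤-respʳ (*-congʳ (sym ∣x∣≈-x)) (∣w*x∣≤ y (≤-respʳ ∣x∣≈-x (∣∣-nonNeg x)))))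

  *-monoˡ-≤ : ∀ {w x y} → 0# ≤ w → x ≤ y → x * w ≤ y * w
  *-monoˡ-≤ 0≤w x≤y = ≤-respˡ (*-comm _ _) (≤-respʳ (*-comm _ _) (*-monoʳ-≤ 0≤w x≤y))

  *-mono-≤ : ∀ {w x y z} → 0# ≤ y → 0# ≤ x → w ≤ x → y ≤ z → w * y ≤ x * z
  *-mono-≤ 0≤y 0≤x w≤x y≤z = ≤-trans (*-monoˡ-≤ 0≤y w≤x) (*-monoʳ-≤ 0≤x y≤z)

  ^-nonNeg : ∀ {x} n → 0# ≤ x → 0# ≤ x ^ n
  ^-nonNeg zero    0≤x = 0≤1
  ^-nonNeg (suc n) 0≤x = *-nonNeg 0≤x (^-nonNeg n 0≤x)

  ^-mono-≤ : ∀ {x y} n → 0# ≤ x → x ≤ y → x ^ n ≤ y ^ n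
  ^-mono-≤ zero    0≤x x≤y = ≤-refl
  ^-mono-≤ (suc n) 0≤x x≤y = *-mono-≤ (^-nonNeg n 0≤x) (≤-trans 0≤x x≤y) x≤y (^-mono-≤ n 0≤x x≤y)

  ∑-nonNeg : (as : List A) {f : A → Carrier} → (∀ a → 0# ≤ f a) → 0# ≤ ∑ as f
  ∑-nonNeg as 0≤f = ≤-respˡ (∑-zero as) (∑-mono as 0≤f)

  -- Keeps the membership proof available to the termwise bound, which for level-k sums holds only
  -- when `I` has size k.
  ∑-mono-filter : {P : Pred A lzero} (P? : Decidable P) (as : List A) {f g : A → Carrier} →
                  (∀ a → P a → f a ≤ g a) → ∑ (filter P? as) f ≤ ∑ (filter P? as) g
  ∑-mono-filter P? []       p = ≤-refl
  ∑-mono-filter P? (a ∷ as) p with P? a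
  ... | yes Pa = +-mono-≤ (p a Pa) (∑-mono-filter P? as p)
  ... | no _   = ∑-mono-filter P? as p

  -- Simulating one gadget by another, block by block.

  restrict : Subset.Side → Sign → Sign
  restrict inside  s = s
  restrict outside s = Sign.+

  χ-∷ : ∀ i (I : Subset n) s z → ⟦ χ (i ∷ I) (s ∷ z) ⟧ ≈ ⟦ χ I z ⟧ * ⟦ restrict i s ⟧
  χ-∷ inside  I s z = trans (⟦⟧-homo s (χ I z)) (*-comm _ _)
  χ-∷ outside I s z = sym (*-identityʳ _)

  scale : Carrier → Subset.Side → Carrier
  scale κ inside  = κ
  scale κ outside = 1#

  scale-∷ : ∀ κ i (I : Subset n) → scale κ i * κ ^ Subset.∣ I ∣ ≈ κ ^ Subset.∣ i ∷ I ∣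
  scale-∷ κ inside  I = refl
  scale-∷ κ outside I = *-identityˡ _

  -- A block of inputs of g is replaced by a random function of a block of
  -- inputs of h, which simultaneously turns uniform blocks into uniform blocks
  -- and turns averages against κ g into (signed) averages against h.
  record Simulation (g : Gadget m₁ m₂) {p₁ p₂ : ℕ} (h : Gadget p₁ p₂) (κ : Carrier) : Set (lsuc lzero ⊔ˡ ℓ) where
    field
      Index     : Set
      indices   : List Index
      coef      : Subset.Side → Index → Carrier
      ∣coef∣≤   : ∀ i w → ∣ coef i w ∣ ≤ coef outside w
      left      : Index → Cube p₁ → Cube m₁
      right     : Index → Cube p₂ → Cube m₂
      simulates : ∀ i (F : Cube m₁ → Cube m₂ → Carrier) →
        (∑[ w ← indices ] coef i w * (𝔼[ a ← cube p₁ ] 𝔼[ b ← cube p₂ ]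
           F (left w a) (right w b) * ⟦ restrict i (h a b) ⟧)) ≈
        scale κ i * (𝔼[ x ← cube m₁ ] 𝔼[ y ← cube m₂ ] F x y * ⟦ restrict i (g x y) ⟧)

  -- For balanced g and F the value of a protocol this is the Fourier coefficient of its fiber. F is
  -- arbitrary because fixing the first blocks in the induction leaves a function that is not
  -- presented as a protocol.
  correlation : Gadget m₁ m₂ → Subset n → (Inputs m₁ n → Inputs m₂ n → Carrier) → Carrier
  correlation {m₁} {m₂} {n} g I F =
    𝔼 (inputs m₁ m₂ n) (uncurry λ xs ys → F xs ys * ⟦ χ I (zipWith g xs ys) ⟧)

  correlation-∷ : (g : Gadget m₁ m₂) → ∀ i (I : Subset n) F →
    correlation g (i ∷ I) F ≈
    (𝔼[ x ← cube m₁ ] 𝔼[ y ← cube m₂ ]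
       correlation g I (λ xs ys → F (x ∷ xs) (y ∷ ys)) * ⟦ restrict i (g x y) ⟧)
  correlation-∷ {m₁} {m₂} {n} g i I F = begin
    correlation g (i ∷ I) F
      ≈⟨ 𝔼-inputs-suc m₁ m₂ n (λ xs ys → F xs ys * ⟦ χ (i ∷ I) (zipWith g xs ys) ⟧) ⟩
    (𝔼[ x ← cube m₁ ] 𝔼[ y ← cube m₂ ] 𝔼 (inputs m₁ m₂ n)
       (uncurry λ xs ys → F (x ∷ xs) (y ∷ ys) * ⟦ χ (i ∷ I) (g x y ∷ zipWith g xs ys) ⟧))
      ≈⟨ 𝔼-cong (cube m₁) (λ x → 𝔼-cong (cube m₂) λ y → trans
           (𝔼-cong (inputs m₁ m₂ n) λ (xs , ys) →
             trans (*-congˡ (χ-∷ i I (g x y) (zipWith g xs ys))) (sym (*-assoc _ _ _)))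
           (sym (𝔼-* (inputs m₁ m₂ n) _ _))) ⟩
    (𝔼[ x ← cube m₁ ] 𝔼[ y ← cube m₂ ]
       correlation g I (λ xs ys → F (x ∷ xs) (y ∷ ys)) * ⟦ restrict i (g x y) ⟧) ∎

  -- Each player transforms the own input before speaking, so the depth d is unchanged.
  relabel : ∀ {X Y X′ Y′ : Set} → (X′ → X) → (Y′ → Y) → Protocol X Y d → Protocol X′ Y′ d
  relabel α β (output s)  = output s
  relabel α β (alice b P) = alice (λ x → b (α x)) (λ r → relabel α β (P r))
  relabel α β (bob b P)   = bob (λ y → b (β y)) (λ r → relabel α β (P r))

  run-relabel : ∀ {X Y X′ Y′ : Set} (α : X′ → X) (β : Y′ → Y) (P : Protocol X Y d) x y →
                run (relabel α β P) x y ≡ run P (α x) (β y)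
  run-relabel α β (output s)  x y = ≡.refl
  run-relabel α β (alice b P) x y = run-relabel α β (P (b (α x))) x y
  run-relabel α β (bob b P)   x y = run-relabel α β (P (b (β y))) x y

  relabelRandomized : ∀ {X Y X′ Y′ : Set} → (X′ → X) → (Y′ → Y) →
                      RandomizedProtocol X Y d → RandomizedProtocol X′ Y′ d
  relabelRandomized α β C = record
    { outcomes = outcomes
    ; weight   = weight
    ; nonNeg   = nonNeg
    ; total    = total
    ; protocol = λ r → relabel α β (protocol r)
    }
    where open RandomizedProtocol C

  value-relabel : ∀ {X Y X′ Y′ : Set} (α : X′ → X) (β : Y′ → Y) (C : RandomizedProtocol X Y d) x y →
                  value (relabelRandomized α β C) x y ≈ value C (α x) (β y)
  value-relabel α β C x y = ∑-cong (allFin outcomes) λ r →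
    *-congˡ (reflexive (≡.cong ⟦_⟧ (run-relabel α β (protocol r) x y)))
    where open RandomizedProtocol C

  L₁≤L₁sup : (g : Gadget m₁ m₂) (k : ℕ) (C : RandomizedProtocol (Inputs m₁ n) (Inputs m₂ n) d) →
             L₁ k (fiber g C) ≤ L₁sup g k d n
  L₁≤L₁sup g k C = proj₁ (proj₂ (complete _ _ _)) C

  L₁sup≤ : (g : Gadget m₁ m₂) (k : ℕ) {b : Carrier} →
           (∀ (C : RandomizedProtocol (Inputs m₁ n) (Inputs m₂ n) d) → L₁ k (fiber g C) ≤ b) →
           L₁sup g k d n ≤ b
  L₁sup≤ g k bound = proj₂ (proj₂ (complete _ _ _)) _ bound

  L₁sup-nonNeg : (g : Gadget m₁ m₂) (k : ℕ) → 0# ≤ L₁sup g k d n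
  L₁sup-nonNeg {n = n} g k =
    ≤-trans (∑-nonNeg (subsetsOfSize n k) λ I → ∣∣-nonNeg _) (L₁≤L₁sup g k constant)

  module _ (g : Gadget m₁ m₂) {p₁ p₂ : ℕ} (h : Gadget p₁ p₂) {κ : Carrier} (sim : Simulation g h κ) where
    open Simulation sim

    -- For `I` = `⊥` these are the probabilities of a sequence of choices; every other `I` gives a
    -- signed variant bounded by them in absolute value.
    coefs : Subset n → Vec Index n → Carrier
    coefs []      []       = 1#
    coefs (i ∷ I) (w ∷ ws) = coef i w * coefs I ws

    coef-nonNeg : ∀ w → 0# ≤ coef outside w
    coef-nonNeg w = ≤-trans (∣∣-nonNeg _) (∣coef∣≤ outside w)

    coefs-nonNeg : (ws : Vec Index n) → 0# ≤ coefs ⊥ ws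
    coefs-nonNeg []       = 0≤1
    coefs-nonNeg (w ∷ ws) = *-nonNeg (coef-nonNeg w) (coefs-nonNeg ws)

    ∣coefs∣≤ : (I : Subset n) (ws : Vec Index n) → ∣ coefs I ws ∣ ≤ coefs ⊥ ws
    ∣coefs∣≤ []      []       = ∣1∣≤1
    ∣coefs∣≤ (i ∷ I) (w ∷ ws) = ≤-trans (∣x*y∣≤ (coef i w) (coefs I ws))
      (*-mono-≤ (∣∣-nonNeg _) (coef-nonNeg w) (∣coef∣≤ i w) (∣coefs∣≤ I ws))

    -- Simulating the constant function 1 on a block outside `I` reads off the total mass.
    ∑-coef : ∑ indices (coef outside) ≈ 1#
    ∑-coef = begin
      ∑ indices (coef outside)
        ≈⟨ ∑-cong indices (λ w → trans (*-congˡ (trans (𝔼-cong (cube p₁) λ a → 𝔼-cube-const p₂ 1#)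
             (𝔼-cube-const p₁ 1#))) (*-identityʳ _)) ⟨
      (∑[ w ← indices ] coef outside w * (𝔼[ a ← cube p₁ ] 𝔼[ b ← cube p₂ ] 1#))
        ≈⟨ ∑-cong indices (λ w → *-congˡ (𝔼-cong (cube p₁) λ a → 𝔼-cong (cube p₂) λ b → *-identityˡ 1#)) ⟨
      (∑[ w ← indices ] coef outside w * (𝔼[ a ← cube p₁ ] 𝔼[ b ← cube p₂ ] 1# * 1#))
        ≈⟨ simulates outside (λ _ _ → 1#) ⟩
      1# * (𝔼[ x ← cube m₁ ] 𝔼[ y ← cube m₂ ] 1# * 1#)
        ≈⟨ trans (*-identityˡ _) (𝔼-cong (cube m₁) λ x → 𝔼-cong (cube m₂) λ y → *-identityˡ 1#) ⟩
      (𝔼[ x ← cube m₁ ] 𝔼[ y ← cube m₂ ] 1#)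
        ≈⟨ trans (𝔼-cong (cube m₁) λ x → 𝔼-cube-const m₂ 1#) (𝔼-cube-const m₁ 1#) ⟩
      1# ∎

    ∑-coefs : ∀ n → (∑[ ws ← words indices n ] coefs ⊥ ws) ≈ 1#
    ∑-coefs zero    = +-identityʳ 1#
    ∑-coefs (suc n) = begin
      (∑[ ws ← words indices (suc n) ] coefs ⊥ ws)
        ≈⟨ ∑-productWith _∷_ indices (words indices n) _ ⟩
      (∑[ w ← indices ] ∑[ ws ← words indices n ] coef outside w * coefs ⊥ ws)
        ≈⟨ ∑-cong indices (λ w → trans (sym (*-∑ (words indices n) _ _))
             (trans (*-congˡ (∑-coefs n)) (*-identityʳ _))) ⟩
      ∑ indices (coef outside) ≈⟨ ∑-coef ⟩
      1# ∎

    simulated : Vec Index n → (Inputs m₁ n → Inputs m₂ n → Carrier) → Inputs p₁ n → Inputs p₂ n → Carrier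
    simulated ws F as bs = F (zipWith left ws as) (zipWith right ws bs)

    -- The choices for different blocks are independent, so blocks can be exchanged one at a time.
    -- With the first blocks of both players fixed, the remaining ones are handled by induction, and
    -- the first block is exchanged last.
    correlation-simulated : (I : Subset n) (F : Inputs m₁ n → Inputs m₂ n → Carrier) →
      (∑[ ws ← words indices n ] coefs I ws * correlation h I (simulated ws F)) ≈
      κ ^ Subset.∣ I ∣ * correlation g I F
    correlation-simulated [] F = begin
      1# * correlation h [] (simulated [] F) + 0#
        ≈⟨ +-identityʳ _ ⟩
      1# * correlation h [] (simulated [] F)
        ≈⟨ *-congˡ (trans (𝔼-inputs-zero p₁ p₂ (λ as bs → simulated [] F as bs * ⟦ χ [] (zipWith h as bs) ⟧))
             (sym (𝔼-inputs-zero m₁ m₂ (λ xs ys → F xs ys * ⟦ χ [] (zipWith g xs ys) ⟧)))) ⟩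
      1# * correlation g [] F ∎
    correlation-simulated {suc n} (i ∷ I) F = begin
      (∑[ ws ← words indices (suc n) ] coefs (i ∷ I) ws * correlation h (i ∷ I) (simulated ws F))
        ≈⟨ ∑-productWith _∷_ indices (words indices n) _ ⟩
      (∑[ w ← indices ] ∑[ ws ← words indices n ]
         coef i w * coefs I ws * correlation h (i ∷ I) (simulated (w ∷ ws) F))
        ≈⟨ ∑-cong indices (λ w → trans (∑-cong (words indices n) λ ws → *-assoc _ _ _)
             (sym (*-∑ (words indices n) _ _))) ⟩
      (∑[ w ← indices ] coef i w * (∑[ ws ← words indices n ]
         coefs I ws * correlation h (i ∷ I) (simulated (w ∷ ws) F)))
        ≈⟨ ∑-cong indices (λ w → *-congˡ (collect w)) ⟩
      (∑[ w ← indices ] coef i w * (𝔼[ a ← cube p₁ ] 𝔼[ b ← cube p₂ ]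
         G (left w a) (right w b) * ⟦ restrict i (h a b) ⟧))
        ≈⟨ simulates i G ⟩
      scale κ i * (𝔼[ x ← cube m₁ ] 𝔼[ y ← cube m₂ ] G x y * ⟦ restrict i (g x y) ⟧)
        ≈⟨ *-congˡ (trans (𝔼-cong (cube m₁) λ x →
             trans (𝔼-cong (cube m₂) λ y → *-assoc _ _ _) (sym (*-𝔼 (cube m₂) _ _)))
             (sym (*-𝔼 (cube m₁) _ _))) ⟩
      scale κ i * (κ ^ Subset.∣ I ∣ * (𝔼[ x ← cube m₁ ] 𝔼[ y ← cube m₂ ]
         correlation g I (λ xs ys → F (x ∷ xs) (y ∷ ys)) * ⟦ restrict i (g x y) ⟧))
        ≈⟨ *-congˡ (*-congˡ (correlation-∷ g i I F)) ⟨
      scale κ i * (κ ^ Subset.∣ I ∣ * correlation g (i ∷ I) F)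
        ≈⟨ trans (sym (*-assoc _ _ _)) (*-congʳ (scale-∷ κ i I)) ⟩
      κ ^ Subset.∣ i ∷ I ∣ * correlation g (i ∷ I) F ∎
      where
      G : Cube m₁ → Cube m₂ → Carrier
      -- The correlation over the remaining blocks, already converted to g, as a function of the
      -- first block; this is the F to which `simulates` is applied.
      G x y = κ ^ Subset.∣ I ∣ * correlation g I (λ xs ys → F (x ∷ xs) (y ∷ ys))

      F′ : Index → Cube p₁ → Cube p₂ → Inputs m₁ n → Inputs m₂ n → Carrier
      F′ w a b xs ys = F (left w a ∷ xs) (right w b ∷ ys)

      collect : ∀ w →
        (∑[ ws ← words indices n ] coefs I ws * correlation h (i ∷ I) (simulated (w ∷ ws) F)) ≈
        (𝔼[ a ← cube p₁ ] 𝔼[ b ← cube p₂ ] G (left w a) (right w b) * ⟦ restrict i (h a b) ⟧)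
      collect w = begin
        (∑[ ws ← words indices n ] coefs I ws * correlation h (i ∷ I) (simulated (w ∷ ws) F))
          ≈⟨ ∑-cong (words indices n) (λ ws → trans (*-congˡ (correlation-∷ h i I (simulated (w ∷ ws) F)))
               (trans (*-𝔼 (cube p₁) _ _) (𝔼-cong (cube p₁) λ a →
                 trans (*-𝔼 (cube p₂) _ _) (𝔼-cong (cube p₂) λ b → sym (*-assoc _ _ _))))) ⟩
        (∑[ ws ← words indices n ] 𝔼[ a ← cube p₁ ] 𝔼[ b ← cube p₂ ]
           coefs I ws * correlation h I (simulated ws (F′ w a b)) * ⟦ restrict i (h a b) ⟧)
          ≈⟨ 𝔼-∑ (cube p₁) (words indices n) _ ⟨
        (𝔼[ a ← cube p₁ ] ∑[ ws ← words indices n ] 𝔼[ b ← cube p₂ ]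
           coefs I ws * correlation h I (simulated ws (F′ w a b)) * ⟦ restrict i (h a b) ⟧)
          ≈⟨ 𝔼-cong (cube p₁) (λ a → trans (𝔼-cong (cube p₂) λ b → ∑-* (words indices n) _ _)
               (𝔼-∑ (cube p₂) (words indices n) _)) ⟨
        (𝔼[ a ← cube p₁ ] 𝔼[ b ← cube p₂ ] (∑[ ws ← words indices n ]
           coefs I ws * correlation h I (simulated ws (F′ w a b))) * ⟦ restrict i (h a b) ⟧)
          ≈⟨ 𝔼-cong (cube p₁) (λ a → 𝔼-cong (cube p₂) λ b →
               *-congʳ (correlation-simulated I (F′ w a b))) ⟩
        (𝔼[ a ← cube p₁ ] 𝔼[ b ← cube p₂ ] G (left w a) (right w b) * ⟦ restrict i (h a b) ⟧) ∎

    module _ (g-balanced : Balanced g) (h-balanced : Balanced h) {Λ : Carrier}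
             (0≤Λ : 0# ≤ Λ) (Λκ≈1 : Λ * κ ≈ 1#) where

      Λ^k*κ^k≈1 : ∀ k → Λ ^ k * κ ^ k ≈ 1#
      Λ^k*κ^k≈1 zero    = *-identityˡ 1#
      Λ^k*κ^k≈1 (suc k) = begin
        Λ * Λ ^ k * (κ * κ ^ k)
          ≈⟨ solve 4 (λ a b c d → a :* b :* (c :* d) := a :* c :* (b :* d)) refl Λ (Λ ^ k) κ (κ ^ k) ⟩
        Λ * κ * (Λ ^ k * κ ^ k) ≈⟨ *-cong Λκ≈1 (Λ^k*κ^k≈1 k) ⟩
        1# * 1#                 ≈⟨ *-identityˡ 1# ⟩
        1# ∎

      module _ (C : RandomizedProtocol (Inputs m₁ n) (Inputs m₂ n) d) where

        simulator : Vec Index n → RandomizedProtocol (Inputs p₁ n) (Inputs p₂ n) d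
        simulator ws = relabelRandomized (zipWith left ws) (zipWith right ws) C

        fourier-simulator : (I : Subset n) (ws : Vec Index n) →
          fourier (fiber h (simulator ws)) I ≈ correlation h I (simulated ws (value C))
        fourier-simulator I ws = trans (fourier-fiber h h-balanced (simulator ws) I)
          (𝔼-cong (inputs p₁ p₂ n) λ (as , bs) →
            *-congʳ (value-relabel (zipWith left ws) (zipWith right ws) C as bs))

        -- After the triangle inequality the weights `coefs ⊥ ws` and the simulators are the same
        -- for every `I`; only then can the bounds be summed over `I`.
        ∣fourier-fiber∣≤ : (I : Subset n) →
          ∣ fourier (fiber g C) I ∣ ≤
          Λ ^ Subset.∣ I ∣ * (∑[ ws ← words indices n ] coefs ⊥ ws * ∣ fourier (fiber h (simulator ws)) I ∣)
        ∣fourier-fiber∣≤ I = ≤-respˡ (∣∣-cong (sym expand))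
          (≤-trans (∣w*x∣≤ _ 0≤Λ^k) (*-monoʳ-≤ 0≤Λ^k (≤-trans (∣∑∣≤ (words indices n) _)
            (∑-mono (words indices n) λ ws → ≤-trans (∣x*y∣≤ (coefs I ws) _)
              (*-monoˡ-≤ (∣∣-nonNeg _) (∣coefs∣≤ I ws))))))
          where
          0≤Λ^k : 0# ≤ Λ ^ Subset.∣ I ∣
          0≤Λ^k = ^-nonNeg Subset.∣ I ∣ 0≤Λ

          expand : fourier (fiber g C) I ≈
            Λ ^ Subset.∣ I ∣ * (∑[ ws ← words indices n ] coefs I ws * fourier (fiber h (simulator ws)) I)
          expand = begin
            fourier (fiber g C) I
              ≈⟨ fourier-fiber g g-balanced C I ⟩
            correlation g I (value C)
              ≈⟨ trans (*-congʳ (Λ^k*κ^k≈1 Subset.∣ I ∣)) (*-identityˡ _) ⟨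
            Λ ^ Subset.∣ I ∣ * κ ^ Subset.∣ I ∣ * correlation g I (value C)
              ≈⟨ *-assoc _ _ _ ⟩
            Λ ^ Subset.∣ I ∣ * (κ ^ Subset.∣ I ∣ * correlation g I (value C))
              ≈⟨ *-congˡ (correlation-simulated I (value C)) ⟨
            Λ ^ Subset.∣ I ∣ * (∑[ ws ← words indices n ] coefs I ws * correlation h I (simulated ws (value C)))
              ≈⟨ *-congˡ (∑-cong (words indices n) λ ws → *-congˡ (fourier-simulator I ws)) ⟨
            Λ ^ Subset.∣ I ∣ * (∑[ ws ← words indices n ] coefs I ws * fourier (fiber h (simulator ws)) I) ∎

        -- Exchanging the sums over `I` and over choices leaves a probability average of level-k
        -- weights of fibers of h, each at most the supremum.
        L₁-fiber≤ : ∀ k → L₁ k (fiber g C) ≤ Λ ^ k * L₁sup h k d n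
        L₁-fiber≤ k = ≤-trans
          -- Matching on the membership proof replaces k by the size of `I`, so the exponent of Λ is
          -- the same in all terms.
          (∑-mono-filter _ (subsets n) λ { I ≡.refl → ∣fourier-fiber∣≤ I })
          (≤-respˡ (sym regroup) (*-monoʳ-≤ (^-nonNeg k 0≤Λ) (≤-respʳ average
            (∑-mono (words indices n) λ ws →
              *-monoʳ-≤ (coefs-nonNeg ws) (L₁≤L₁sup h k (simulator ws))))))
          where
          regroup :
            (∑[ I ← subsetsOfSize n k ] Λ ^ k *
               (∑[ ws ← words indices n ] coefs ⊥ ws * ∣ fourier (fiber h (simulator ws)) I ∣)) ≈
            Λ ^ k * (∑[ ws ← words indices n ] coefs ⊥ ws * L₁ k (fiber h (simulator ws)))
          regroup = begin
            (∑[ I ← subsetsOfSize n k ] Λ ^ k *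
               (∑[ ws ← words indices n ] coefs ⊥ ws * ∣ fourier (fiber h (simulator ws)) I ∣))
              ≈⟨ *-∑ (subsetsOfSize n k) _ _ ⟨
            Λ ^ k * (∑[ I ← subsetsOfSize n k ] ∑[ ws ← words indices n ]
               coefs ⊥ ws * ∣ fourier (fiber h (simulator ws)) I ∣)
              ≈⟨ *-congˡ (∑-swap (subsetsOfSize n k) (words indices n) _) ⟩
            Λ ^ k * (∑[ ws ← words indices n ] ∑[ I ← subsetsOfSize n k ]
               coefs ⊥ ws * ∣ fourier (fiber h (simulator ws)) I ∣)
              ≈⟨ *-congˡ (∑-cong (words indices n) λ ws → *-∑ (subsetsOfSize n k) _ _) ⟨
            Λ ^ k * (∑[ ws ← words indices n ] coefs ⊥ ws * L₁ k (fiber h (simulator ws))) ∎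

          average : (∑[ ws ← words indices n ] coefs ⊥ ws * L₁sup h k d n) ≈ L₁sup h k d n
          average = trans (sym (∑-* (words indices n) _ _)) (trans (*-congʳ (∑-coefs n)) (*-identityˡ _))

      L₁sup-simulation : ∀ k d n → L₁sup g k d n ≤ Λ ^ k * L₁sup h k d n
      L₁sup-simulation k d n = L₁sup≤ g k λ C → L₁-fiber≤ C k

  -- XOR simulates every gadget with vanishing marginal coefficients.

  XOR-balanced : Balanced XOR
  XOR-balanced = trans (𝔼-cong (cube 1) {λ a → 𝔼[ b ← cube 1 ] ⟦ XOR a b ⟧} {λ _ → 0#} λ { (s ∷ []) → inner s }) (𝔼-cube-const 1 0#)
    where
    inner : ∀ s → (𝔼[ b ← cube 1 ] ⟦ XOR (s ∷ []) b ⟧) ≈ 0#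
    inner s = begin
      (𝔼[ b ← cube 1 ] ⟦ XOR (s ∷ []) b ⟧)
        ≈⟨ 𝔼-cube-suc 0 (λ b → ⟦ XOR (s ∷ []) b ⟧) ⟩
      (𝔼[ t ← signs ] 𝔼[ y ← cube 0 ] ⟦ XOR (s ∷ []) (t ∷ y) ⟧)
        ≈⟨ 𝔼-cong signs (λ t → 𝔼-cube-zero λ y → ⟦ XOR (s ∷ []) (t ∷ y) ⟧) ⟩
      (𝔼[ t ← signs ] ⟦ s Sign.* t ⟧)
        ≈⟨ 𝔼-signs-shift s ⟦_⟧ ⟩
      𝔼 signs ⟦_⟧
        ≈⟨ 𝔼-signs ⟦_⟧ ⟩
      recip 2 * (1# + - 1#)
        ≈⟨ trans (*-congˡ (-‿inverseʳ 1#)) (zeroʳ _) ⟩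
      0# ∎

  χ-⊥ : (x : Cube m) → χ ⊥ x ≡ Sign.+
  χ-⊥ []      = ≡.refl
  χ-⊥ (s ∷ x) = χ-⊥ x

  inverse-nonNeg : ∀ {x y} → 1# ≤ x → x * y ≈ 1# → 0# ≤ y
  inverse-nonNeg {x} {y} 1≤x xy≈1 with ≤-total 0# y
  ... | inj₁ 0≤y = 0≤y
  ... | inj₂ y≤0 = ⊥-elim (1≉0 (≤-antisym
    (≤-respˡ xy≈1 (≤-respʳ (zeroʳ x) (*-monoʳ-≤ (≤-trans 0≤1 1≤x) y≤0))) 0≤1))

  invertible : ∀ {x} → 1# ≤ x → Σ Carrier λ y → (x * y ≈ 1#) × 0# ≤ y
  invertible {x} 1≤x with inverse x (λ x≈0 → 1≉0 (≤-antisym (≤-respʳ x≈0 1≤x) 0≤1))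
  ... | y , xy≈1 = y , xy≈1 , inverse-nonNeg 1≤x xy≈1

  *-cancelˡ-≤ : ∀ {c x y} → 1# ≤ c → c * x ≤ c * y → x ≤ y
  *-cancelˡ-≤ {c} {x} {y} 1≤c cx≤cy with invertible 1≤c
  ... | i , ci≈1 , 0≤i = ≤-respˡ (undo x) (≤-respʳ (undo y) (*-monoʳ-≤ 0≤i cx≤cy))
    where
    undo : ∀ z → i * (c * z) ≈ z
    undo z = trans (sym (*-assoc i c z)) (trans (*-congʳ (trans (*-comm i c) ci≈1)) (*-identityˡ z))

  module _ (g : Gadget m₁ m₂) where

    ‖g‖ : Carrier
    ‖g‖ = ∑[ S ← subsets m₁ ] ∑[ T ← subsets m₂ ] ∣ gadgetFourier g S T ∣

    -- Evaluate the Fourier expansion at one point, where g has absolute value 1. This makes κ = 1 /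
    -- `‖g‖` available and nonnegative.
    1≤‖g‖ : 1# ≤ ‖g‖
    1≤‖g‖ = ≤-trans (1≤∣sign∣ (g x₀ y₀)) (≤-respˡ (∣∣-cong (gadget-inversion g x₀ y₀))
      (≤-trans (∣∑∣≤ (subsets m₁) _) (∑-mono (subsets m₁) λ S →
        ≤-trans (∣∑∣≤ (subsets m₂) _) (∑-mono (subsets m₂) λ T →
          ≤-respˡ (∣∣-cong (*-assoc _ _ _))
            (≤-trans (∣x*sign∣≤ _ (χ T y₀)) (∣x*sign∣≤ _ (χ S x₀)))))))
      where
      x₀ = replicate m₁ Sign.+
      y₀ = replicate m₂ Sign.+

      1≤∣sign∣ : ∀ s → 1# ≤ ∣ ⟦ s ⟧ ∣
      1≤∣sign∣ Sign.+ = x≤x⊔y 1# (- 1#)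
      1≤∣sign∣ Sign.- = ≤-respˡ (-‿involutive 1#) (x≤y⊔x (- 1#) (- (- 1#)))

    module _ (g-vanishes : ∀ S T → S ≡ ⊥ ⊎ T ≡ ⊥ → gadgetFourier g S T ≈ 0#) where

      vanishing⇒balanced : Balanced g
      vanishing⇒balanced = begin
        (𝔼[ x ← cube m₁ ] 𝔼[ y ← cube m₂ ] ⟦ g x y ⟧)
          ≈⟨ 𝔼-cong (cube m₁) (λ x → 𝔼-cong (cube m₂) λ y → trans
               (*-congˡ (trans (*-cong (reflexive (≡.cong ⟦_⟧ (χ-⊥ x))) (reflexive (≡.cong ⟦_⟧ (χ-⊥ y)))) (*-identityˡ 1#)))
               (*-identityʳ _)) ⟨
        (𝔼[ x ← cube m₁ ] 𝔼[ y ← cube m₂ ] ⟦ g x y ⟧ * (⟦ χ ⊥ x ⟧ * ⟦ χ ⊥ y ⟧))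
          ≈⟨ gadgetFourier-𝔼 g ⊥ ⊥ ⟨
        gadgetFourier g ⊥ ⊥
          ≈⟨ g-vanishes ⊥ ⊥ (inj₁ ≡.refl) ⟩
        0# ∎

      -- The random choice is (S , T) with probability κ ∣ĝ(S,T)∣ and uniform
      -- u, v; the players then enter x = shift S a u and y = shift T b v, so
      -- that χ_S(x) χ_T(y) = a b χ_S(u) χ_T(v).
      module _ {p : ℕ} (h : Gadget p p) (σ : Cube p → Sign) (h-product : ∀ a b → h a b ≡ σ a Sign.* σ b)
               {κ : Carrier} (0≤κ : 0# ≤ κ) (‖g‖κ≈1 : ‖g‖ * κ ≈ 1#) where

        private
          Choice : Set
          Choice = (Subset m₁ × Subset m₂) × (Cube m₁ × Cube m₂)

          choices : List Choice
          choices = cartesianProduct (cartesianProduct (subsets m₁) (subsets m₂))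
                                     (cartesianProduct (cube m₁) (cube m₂))

          density : Subset.Side → Subset m₁ → Subset m₂ → Carrier
          density inside  S T = gadgetFourier g S T
          density outside S T = ∣ gadgetFourier g S T ∣

          character : Subset.Side → Choice → Sign
          character i ((S , T) , (u , v)) = restrict i (χ S u) Sign.* restrict i (χ T v)

          ν : Carrier
          ν = recip (length (cartesianProduct (cube m₁) (cube m₂)))

          -- Outside `I` this is the probability of the choice, ν being that of the masks (u, v).
          -- Inside, the absolute value is the same, and the sign is that of ĝ(S,T) χ_S(u) χ_T(v).
          coefficient : Subset.Side → Choice → Carrier
          coefficient i w@((S , T) , _) = κ * ν * density i S T * ⟦ character i w ⟧

          0≤κν : 0# ≤ κ * ν
          0≤κν = *-nonNeg 0≤κ (0≤recip (length (cartesianProduct (cube m₁) (cube m₂))))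

          ∣coefficient∣≤ : ∀ i w → ∣ coefficient i w ∣ ≤ coefficient outside w
          ∣coefficient∣≤ i w@((S , T) , _) = ≤-trans (∣x*sign∣≤ _ (character i w))
            (≤-respʳ (sym (*-identityʳ _)) (≤-trans (∣w*x∣≤ _ 0≤κν) (*-monoʳ-≤ 0≤κν (∣density∣≤ i))))
            where
            ∣density∣≤ : ∀ i → ∣ density i S T ∣ ≤ ∣ gadgetFourier g S T ∣
            ∣density∣≤ inside  = ≤-refl
            ∣density∣≤ outside = ∣∣x∣∣≤∣x∣ (gadgetFourier g S T)

          ∑-choices : ∀ i (H : Choice → Carrier) →
            (∑[ w ← choices ] coefficient i w * H w) ≈
            κ * (∑[ S ← subsets m₁ ] ∑[ T ← subsets m₂ ] density i S T *
              (𝔼[ u ← cube m₁ ] 𝔼[ v ← cube m₂ ] ⟦ character i ((S , T) , (u , v)) ⟧ * H ((S , T) , (u , v))))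
          ∑-choices i H = begin
            (∑[ w ← choices ] coefficient i w * H w)
              ≈⟨ ∑-productWith _,_ (cartesianProduct (subsets m₁) (subsets m₂)) (cartesianProduct (cube m₁) (cube m₂)) _ ⟩
            (∑[ ST ← cartesianProduct (subsets m₁) (subsets m₂) ] ∑[ uv ← cartesianProduct (cube m₁) (cube m₂) ]
               coefficient i (ST , uv) * H (ST , uv))
              ≈⟨ ∑-productWith _,_ (subsets m₁) (subsets m₂) _ ⟩
            (∑[ S ← subsets m₁ ] ∑[ T ← subsets m₂ ] ∑[ uv ← cartesianProduct (cube m₁) (cube m₂) ]
               coefficient i ((S , T) , uv) * H ((S , T) , uv))
              ≈⟨ ∑-cong (subsets m₁) (λ S → ∑-cong (subsets m₂) λ T → average S T) ⟩
            (∑[ S ← subsets m₁ ] ∑[ T ← subsets m₂ ] κ * (density i S T *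
              (𝔼[ u ← cube m₁ ] 𝔼[ v ← cube m₂ ] ⟦ character i ((S , T) , (u , v)) ⟧ * H ((S , T) , (u , v)))))
              ≈⟨ trans (*-∑ (subsets m₁) _ _) (∑-cong (subsets m₁) λ S → *-∑ (subsets m₂) _ _) ⟨
            κ * (∑[ S ← subsets m₁ ] ∑[ T ← subsets m₂ ] density i S T *
              (𝔼[ u ← cube m₁ ] 𝔼[ v ← cube m₂ ] ⟦ character i ((S , T) , (u , v)) ⟧ * H ((S , T) , (u , v)))) ∎
            where
            average : ∀ S T →
              (∑[ uv ← cartesianProduct (cube m₁) (cube m₂) ] coefficient i ((S , T) , uv) * H ((S , T) , uv)) ≈
              κ * (density i S T *
                (𝔼[ u ← cube m₁ ] 𝔼[ v ← cube m₂ ] ⟦ character i ((S , T) , (u , v)) ⟧ * H ((S , T) , (u , v))))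
            average S T = begin
              (∑[ uv ← cartesianProduct (cube m₁) (cube m₂) ] coefficient i ((S , T) , uv) * H ((S , T) , uv))
                ≈⟨ ∑-cong (cartesianProduct (cube m₁) (cube m₂)) (λ uv → *-assoc _ _ _) ⟩
              (∑[ uv ← cartesianProduct (cube m₁) (cube m₂) ] κ * ν * density i S T *
                 (⟦ character i ((S , T) , uv) ⟧ * H ((S , T) , uv)))
                ≈⟨ *-∑ (cartesianProduct (cube m₁) (cube m₂)) _ _ ⟨
              κ * ν * density i S T * (∑[ uv ← cartesianProduct (cube m₁) (cube m₂) ]
                 ⟦ character i ((S , T) , uv) ⟧ * H ((S , T) , uv))
                ≈⟨ solve 4 (λ k n d s → k :* n :* d :* s := k :* (d :* (n :* s))) refl κ ν (density i S T)
                     (∑[ uv ← cartesianProduct (cube m₁) (cube m₂) ] ⟦ character i ((S , T) , uv) ⟧ * H ((S , T) , uv)) ⟩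
              κ * (density i S T * (𝔼[ uv ← cartesianProduct (cube m₁) (cube m₂) ]
                 ⟦ character i ((S , T) , uv) ⟧ * H ((S , T) , uv)))
                ≈⟨ *-congˡ (*-congˡ (𝔼-productWith _,_ (cube m₁) (cube m₂) _)) ⟩
              κ * (density i S T *
                (𝔼[ u ← cube m₁ ] 𝔼[ v ← cube m₂ ] ⟦ character i ((S , T) , (u , v)) ⟧ * H ((S , T) , (u , v)))) ∎

          pulled : (Cube m₁ → Cube m₂ → Carrier) → Subset.Side → Choice → Carrier
          pulled F i ((S , T) , (u , v)) =
            𝔼[ a ← cube p ] 𝔼[ b ← cube p ] F (shift S (σ a) u) (shift T (σ b) v) * ⟦ restrict i (h a b) ⟧

          coefficient-simulates : ∀ i (F : Cube m₁ → Cube m₂ → Carrier) →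
            (∑[ w ← choices ] coefficient i w * pulled F i w) ≈
            scale κ i * (𝔼[ x ← cube m₁ ] 𝔼[ y ← cube m₂ ] F x y * ⟦ restrict i (g x y) ⟧)
          coefficient-simulates inside F = begin
            (∑[ w ← choices ] coefficient inside w * pulled F inside w)
              ≈⟨ ∑-choices inside (pulled F inside) ⟩
            κ * (∑[ S ← subsets m₁ ] ∑[ T ← subsets m₂ ] gadgetFourier g S T *
              (𝔼[ u ← cube m₁ ] 𝔼[ v ← cube m₂ ]
                 ⟦ χ S u Sign.* χ T v ⟧ * pulled F inside ((S , T) , (u , v))))
              ≈⟨ *-congˡ (∑-cong (subsets m₁) λ S → ∑-cong (subsets m₂) λ T → term S T) ⟩
            κ * (∑[ S ← subsets m₁ ] ∑[ T ← subsets m₂ ] gadgetFourier g S T *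
              (𝔼[ x ← cube m₁ ] 𝔼[ y ← cube m₂ ] F x y * (⟦ χ S x ⟧ * ⟦ χ T y ⟧)))
              ≈⟨ *-congˡ (gadget-expansion g F) ⟨
            κ * (𝔼[ x ← cube m₁ ] 𝔼[ y ← cube m₂ ] F x y * ⟦ g x y ⟧) ∎
            where
            vanish : ∀ S T → S ≡ ⊥ ⊎ T ≡ ⊥ → ∀ {r s} → gadgetFourier g S T * r ≈ gadgetFourier g S T * s
            vanish S T empty = trans (trans (*-congʳ (g-vanishes S T empty)) (zeroˡ _))
              (sym (trans (*-congʳ (g-vanishes S T empty)) (zeroˡ _)))

            term : ∀ S T →
              gadgetFourier g S T * (𝔼[ u ← cube m₁ ] 𝔼[ v ← cube m₂ ]
                ⟦ χ S u Sign.* χ T v ⟧ * pulled F inside ((S , T) , (u , v))) ≈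
              gadgetFourier g S T *
                (𝔼[ x ← cube m₁ ] 𝔼[ y ← cube m₂ ] F x y * (⟦ χ S x ⟧ * ⟦ χ T y ⟧))
            -- Planting a sign needs both sets nonempty; in the remaining cases ĝ(S,T) = 0 makes
            -- both sides zero.
            term S T with ≡-dec Bool._≟_ S ⊥ | ≡-dec Bool._≟_ T ⊥
            ... | yes S≡⊥ | _       = vanish S T (inj₁ S≡⊥)
            ... | no _    | yes T≡⊥ = vanish S T (inj₂ T≡⊥)
            ... | no S≢⊥  | no T≢⊥  = *-congˡ (trans
              (𝔼-cong (cube m₁) λ u → 𝔼-cong (cube m₂) λ v → *-cong (⟦⟧-homo (χ S u) (χ T v))
                (𝔼-cong (cube p) λ a → 𝔼-cong (cube p) λ b → *-congˡ (reflexive (≡.cong ⟦_⟧ (h-product a b)))))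
              (𝔼-pull₂-χ σ S T S≢⊥ T≢⊥ F))
          coefficient-simulates outside F = begin
            (∑[ w ← choices ] coefficient outside w * pulled F outside w)
              ≈⟨ ∑-choices outside (pulled F outside) ⟩
            κ * (∑[ S ← subsets m₁ ] ∑[ T ← subsets m₂ ] ∣ gadgetFourier g S T ∣ *
              (𝔼[ u ← cube m₁ ] 𝔼[ v ← cube m₂ ] 1# * pulled F outside ((S , T) , (u , v))))
              ≈⟨ *-congˡ (∑-cong (subsets m₁) λ S → ∑-cong (subsets m₂) λ T → *-congˡ (trans
                   -- Here `𝔼-pull₂` makes the inputs uniform whatever S and T are, so every pair
                   -- contributes the same mean and only the total mass `‖g‖` κ = 1 remains.
                   (𝔼-cong (cube m₁) λ u → 𝔼-cong (cube m₂) λ v → *-identityˡ _)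
                   (𝔼-pull₂ σ S T λ x y → F x y * 1#))) ⟩
            κ * (∑[ S ← subsets m₁ ] ∑[ T ← subsets m₂ ] ∣ gadgetFourier g S T ∣ * mean)
              ≈⟨ *-congˡ (trans (∑-* (subsets m₁) _ _) (∑-cong (subsets m₁) λ S → ∑-* (subsets m₂) _ _)) ⟨
            κ * (‖g‖ * mean)
              ≈⟨ trans (sym (*-assoc _ _ _)) (*-congʳ (trans (*-comm κ ‖g‖) ‖g‖κ≈1)) ⟩
            1# * mean ∎
            where
            mean : Carrier
            mean = 𝔼[ x ← cube m₁ ] 𝔼[ y ← cube m₂ ] F x y * 1#

        productSimulation : Simulation g h κ
        productSimulation = record
          { Index     = Choice
          ; indices   = choices
          ; coef      = coefficient
          ; ∣coef∣≤   = ∣coefficient∣≤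
          ; left      = λ ((S , _) , (u , _)) a → shift S (σ a) u
          ; right     = λ ((_ , T) , (_ , v)) b → shift T (σ b) v
          ; simulates = coefficient-simulates
          }

      L₁sup≤‖g‖^k*L₁sup-XOR : ∀ k d n → L₁sup g k d n ≤ ‖g‖ ^ k * L₁sup XOR k d n
      L₁sup≤‖g‖^k*L₁sup-XOR k d n =
        let κ , ‖g‖κ≈1 , 0≤κ = invertible 1≤‖g‖ in
        L₁sup-simulation g XOR
          (productSimulation XOR head (λ { (a ∷ []) (b ∷ []) → ≡.refl }) 0≤κ ‖g‖κ≈1)
          vanishing⇒balanced XOR-balanced (≤-trans 0≤1 1≤‖g‖) ‖g‖κ≈1 k d n

  -- The bound on the spectral norm, and the square root of 2.

  square-nonNeg : ∀ x → 0# ≤ x * x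
  square-nonNeg x with ≤-total 0# x
  ... | inj₁ 0≤x = *-nonNeg 0≤x 0≤x
  ... | inj₂ x≤0 = ≤-respʳ
    (trans (sym (-‿distribˡ-* x (- x))) (trans (-‿cong (sym (-‿distribʳ-* x x))) (-‿involutive _)))
    (*-nonNeg (x≤0⇒0≤-x x≤0) (x≤0⇒0≤-x x≤0))

  ∣x∣*∣x∣≈x*x : ∀ x → ∣ x ∣ * ∣ x ∣ ≈ x * x
  ∣x∣*∣x∣≈x*x x with ⊔-sel x (- x)
  ... | inj₁ ∣x∣≈x  = *-cong ∣x∣≈x ∣x∣≈x
  ... | inj₂ ∣x∣≈-x = trans (*-cong ∣x∣≈-x ∣x∣≈-x)
    (trans (sym (-‿distribˡ-* x (- x))) (trans (-‿cong (sym (-‿distribʳ-* x x))) (-‿involutive _)))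

  -- This is (x - 1)² ≥ 0. Summed with a suitable scaling it replaces Cauchy-Schwarz and avoids
  -- square roots of sums.
  x+x≤x*x+1 : ∀ x → x + x ≤ x * x + 1#
  x+x≤x*x+1 x = ≤-respˡ (+-cong y+1≈x y+1≈x) (≤-respʳ (+-congʳ (*-cong y+1≈x y+1≈x))
    (≤-respˡ (+-identityʳ _) (≤-respʳ
      (solve 1 (λ y → (y :+ con 1) :+ (y :+ con 1) :+ y :* y := (y :+ con 1) :* (y :+ con 1) :+ con 1) refl y)
      (+-monoʳ-≤ _ (square-nonNeg y)))))
    where
    y : Carrier
    y = x - 1#
    y+1≈x : y + 1# ≈ x
    y+1≈x = trans (+-assoc x (- 1#) 1#) (trans (+-congˡ (-‿inverseˡ 1#)) (+-identityʳ x))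

  halve-≤ : ∀ {x y} → x + x ≤ y + y → x ≤ y
  halve-≤ p = ≤-respˡ (2·½ _) (≤-respʳ (2·½ _) (*-monoʳ-≤ (0≤recip 2) p))

  √2-sup : IsSupremum {I = Σ Carrier λ x → x * x ≤ 2#} proj₁ √2
  √2-sup = proj₂ (complete _ _ _)

  1≤√2 : 1# ≤ √2
  1≤√2 = proj₁ √2-sup (1# , ≤-respˡ (trans (+-identityʳ _) (sym (*-identityˡ 1#))) (+-monoʳ-≤ 1# 0≤1))

  -- If √2² fell short of 2 by η, then (√2 + η/5)² would still be at most 2.
  2≤√2² : 2# ≤ √2 * √2
  2≤√2² with ≤-total 2# (√2 * √2)
  ... | inj₁ 2≤s² = 2≤s²
  ... | inj₂ s²≤2 = 0≤y-x⇒x≤y (≤-respʳ -η (x≤0⇒0≤-x η≤0))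
    where
    s η ε : Carrier
    s = √2
    η = 2# - s * s
    -- The 5 is 4 + 1: for s ≤ 2 and ε ≤ 1 the increase 2sε + ε² is at most 5ε = η.
    ε = recip 5 * η

    0≤η : 0# ≤ η
    0≤η = x≤y⇒0≤y-x s²≤2

    0≤ε : 0# ≤ ε
    0≤ε = *-nonNeg (0≤recip 5) 0≤η

    s≤2 : s ≤ 2#
    s≤2 = x²≤2⇒x≤2 s s²≤2

    -η : - η ≈ s * s - 2#
    -η = trans (sym (-‿+-comm 2# _)) (trans (+-congˡ (-‿involutive _)) (+-comm _ _))

    5ε≈η : 5 · 1# * ε ≈ η
    5ε≈η = trans (sym (*-assoc _ _ _)) (trans (*-congʳ (recip-inverse 4)) (*-identityˡ η))

    s²+η≈2 : s * s + η ≈ 2#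
    s²+η≈2 = trans (+-comm _ _) (trans (+-assoc _ _ _) (trans (+-congˡ (-‿inverseˡ _)) (+-identityʳ _)))

    η≤1 : η ≤ 1#
    η≤1 = ≤-respˡ (+-identityˡ η) (≤-trans
      (+-mono-≤ {0#} {s * s - 1#} (x≤y⇒0≤y-x (≤-respˡ (*-identityˡ 1#) (*-mono-≤ 0≤1 (≤-trans 0≤1 1≤√2) 1≤√2 1≤√2))) ≤-refl)
      (≤-reflexive (begin
        s * s - 1# + η      ≈⟨ solve 3 (λ a b c → a :+ b :+ c := a :+ c :+ b) refl (s * s) (- 1#) η ⟩
        s * s + η + - 1#    ≈⟨ +-congʳ s²+η≈2 ⟩
        1# + 1# + - 1#      ≈⟨ trans (+-assoc _ _ _) (trans (+-congˡ (-‿inverseʳ 1#)) (+-identityʳ 1#)) ⟩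
        1# ∎)))

    ε≤1 : ε ≤ 1#
    ε≤1 = ≤-trans (≤-respˡ (*-identityˡ ε) (≤-respʳ 5ε≈η (*-monoˡ-≤ 0≤ε (1≤1+n·1 4)))) η≤1

    [s+ε]²≤2 : (s + ε) * (s + ε) ≤ 2#
    [s+ε]²≤2 = ≤-respˡ
      (solve 2 (λ s e → s :* s :+ (s :* e :+ s :* e :+ e :* e) := (s :+ e) :* (s :+ e)) refl s ε)
      (≤-respʳ s²+η≈2 (+-monoʳ-≤ (s * s) (≤-respʳ 5ε≈η (≤-respʳ
        (solve 1 (λ e → (con 1 :+ con 1) :* e :+ (con 1 :+ con 1) :* e :+ con 1 :* e :=
           (con 1 :+ (con 1 :+ (con 1 :+ (con 1 :+ (con 1 :+ con 0))))) :* e) refl ε)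
        (+-mono-≤ (+-mono-≤ (*-monoˡ-≤ 0≤ε s≤2) (*-monoˡ-≤ 0≤ε s≤2)) (*-monoˡ-≤ 0≤ε ε≤1))))))

    ε≤0 : ε ≤ 0#
    ε≤0 = ≤-respˡ (cancel ε) (≤-respʳ (-‿inverseˡ s)
      (+-monoʳ-≤ (- s) (proj₁ √2-sup (s + ε , [s+ε]²≤2))))
      where
      cancel : ∀ e → - s + (s + e) ≈ e
      cancel e = trans (sym (+-assoc _ _ _)) (trans (+-congʳ (-‿inverseˡ s)) (+-identityˡ e))

    η≤0 : η ≤ 0#
    η≤0 = ≤-respˡ 5ε≈η (≤-respʳ (zeroʳ _) (*-monoʳ-≤ (0≤n·1 5) ε≤0))

  1≤√2^ : ∀ m → 1# ≤ √2 ^ m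
  1≤√2^ zero    = ≤-refl
  1≤√2^ (suc m) = ≤-respˡ (*-identityˡ 1#) (*-mono-≤ 0≤1 (≤-trans 0≤1 1≤√2) 1≤√2 (1≤√2^ m))

  -- Each coordinate doubles the number of subsets, and `2≤√2²` absorbs the doubling into two
  -- factors `√2`.
  ∑-subsets-one : ∀ m → (∑[ S ← subsets m ] 1#) ≤ √2 ^ m * √2 ^ m
  ∑-subsets-one zero    = ≤-reflexive (trans (+-identityʳ 1#) (sym (*-identityˡ 1#)))
  ∑-subsets-one (suc m) = ≤-respˡ
    (sym (trans (∑-subsets-suc m _) (trans (∑-cong (subsets m) λ _ → sym (*-identityʳ 2#)) (sym (*-∑ (subsets m) 2# _)))))
    (≤-respʳ (solve 2 (λ r q → r :* r :* (q :* q) := r :* q :* (r :* q)) refl √2 (√2 ^ m))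
      (*-mono-≤ (∑-nonNeg (subsets m) λ _ → 0≤1) (square-nonNeg √2) 2≤√2² (∑-subsets-one m)))

  -- Take x = M |ĝ(S,T)| in 2x ≤ x² + 1 and sum over all pairs. Parseval turns the right side into
  -- M² plus the number of pairs, which is at most M². Thus 2M `‖g‖` ≤ 2M², and 2M cancels; this M
  -- makes the bounds on the two summands equal.
  ‖g‖≤√2^ : (g : Gadget m₁ m₂) → ‖g‖ g ≤ √2 ^ (m₁ ℕ.+ m₂)
  ‖g‖≤√2^ {m₁} {m₂} g = *-cancelˡ-≤ (1≤√2^ (m₁ ℕ.+ m₂)) (halve-≤ (≤-respˡ lhs (≤-trans
    (∑-mono (subsets m₁) λ S → ∑-mono (subsets m₂) λ T → x+x≤x*x+1 (M * ∣ gadgetFourier g S T ∣))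
    (≤-respˡ (sym rhs) (+-monoʳ-≤ (M * M) count)))))
    where
    M : Carrier
    M = √2 ^ (m₁ ℕ.+ m₂)

    a : Subset m₁ → Subset m₂ → Carrier
    a = gadgetFourier g

    M‖g‖ : (∑[ S ← subsets m₁ ] ∑[ T ← subsets m₂ ] M * ∣ a S T ∣) ≈ M * ‖g‖ g
    M‖g‖ = sym (trans (*-∑ (subsets m₁) M _) (∑-cong (subsets m₁) λ S → *-∑ (subsets m₂) M _))

    lhs : (∑[ S ← subsets m₁ ] ∑[ T ← subsets m₂ ] M * ∣ a S T ∣ + M * ∣ a S T ∣) ≈ M * ‖g‖ g + M * ‖g‖ g
    lhs = trans (∑-cong (subsets m₁) λ S → ∑-+ (subsets m₂) _ _)
      (trans (∑-+ (subsets m₁) _ _) (+-cong M‖g‖ M‖g‖))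

    rhs : (∑[ S ← subsets m₁ ] ∑[ T ← subsets m₂ ] M * ∣ a S T ∣ * (M * ∣ a S T ∣) + 1#) ≈
          M * M + (∑[ S ← subsets m₁ ] ∑[ T ← subsets m₂ ] 1#)
    rhs = begin
      (∑[ S ← subsets m₁ ] ∑[ T ← subsets m₂ ] M * ∣ a S T ∣ * (M * ∣ a S T ∣) + 1#)
        ≈⟨ trans (∑-cong (subsets m₁) λ S → ∑-+ (subsets m₂) _ _) (∑-+ (subsets m₁) _ _) ⟩
      (∑[ S ← subsets m₁ ] ∑[ T ← subsets m₂ ] M * ∣ a S T ∣ * (M * ∣ a S T ∣)) + N
        ≈⟨ +-congʳ (∑-cong (subsets m₁) λ S → ∑-cong (subsets m₂) λ T → trans
             (solve 2 (λ m x → m :* x :* (m :* x) := m :* m :* (x :* x)) refl M ∣ a S T ∣)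
             (*-congˡ (∣x∣*∣x∣≈x*x (a S T)))) ⟩
      (∑[ S ← subsets m₁ ] ∑[ T ← subsets m₂ ] M * M * (a S T * a S T)) + N
        ≈⟨ +-congʳ (trans (*-∑ (subsets m₁) _ _) (∑-cong (subsets m₁) λ S → *-∑ (subsets m₂) _ _)) ⟨
      M * M * (∑[ S ← subsets m₁ ] ∑[ T ← subsets m₂ ] a S T * a S T) + N
        ≈⟨ +-congʳ (trans (*-congˡ (parseval g)) (*-identityʳ _)) ⟩
      M * M + N ∎
      where
      N : Carrier
      N = ∑[ S ← subsets m₁ ] ∑[ T ← subsets m₂ ] 1#

    count : (∑[ S ← subsets m₁ ] ∑[ T ← subsets m₂ ] 1#) ≤ M * M
    count = ≤-respˡ
      (trans (∑-* (subsets m₁) _ _) (∑-cong (subsets m₁) λ _ → *-identityˡ _))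
      (≤-respʳ
        (trans (solve 2 (λ p q → p :* p :* (q :* q) := p :* q :* (p :* q)) refl (√2 ^ m₁) (√2 ^ m₂))
          (sym (*-cong (^-homo-* √2 m₁ m₂) (^-homo-* √2 m₁ m₂))))
        (*-mono-≤ (∑-nonNeg (subsets m₂) λ _ → 0≤1) (square-nonNeg _) (∑-subsets-one m₁) (∑-subsets-one m₂)))

theorem7p6 : {ℓ : Level} (ℝ : CompleteOrderedField ℓ) → let open Analysis ℝ in
    {m₁ m₂ : ℕ} (g : Gadget m₁ m₂) →
    ((S : Subset m₁) (T : Subset m₂) → S ≡ ⊥ ⊎ T ≡ ⊥ → gadgetFourier g S T ≈ 0#) →
    (k d n : ℕ) →
    (L₁sup g k d n ≤ (∑[ S ← subsets m₁ ] ∑[ T ← subsets m₂ ] ∣ gadgetFourier g S T ∣) ^ k * L₁sup XOR k d n)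
    × ((∑[ S ← subsets m₁ ] ∑[ T ← subsets m₂ ] ∣ gadgetFourier g S T ∣) ^ k * L₁sup XOR k d n ≤ √2 ^ ((m₁ ℕ.+ m₂) ℕ.* k) * L₁sup XOR k d n)
theorem7p6 ℝ {m₁} {m₂} g g-vanishes k d n =
  L₁sup≤‖g‖^k*L₁sup-XOR ℝ g g-vanishes k d n ,
  *-monoˡ-≤ ℝ (L₁sup-nonNeg ℝ XOR k)
    (≤-respʳ (^-assocʳ √2 (m₁ ℕ.+ m₂) k)
      (^-mono-≤ ℝ k (≤-trans 0≤1 (1≤‖g‖ ℝ g)) (‖g‖≤√2^ ℝ g)))
  where
  open Analysis ℝ
  open Exp (CommutativeRing.semiring commutativeRing) using (^-assocʳ)
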